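{- Conjecture 1 implies the $abc$ conjecture (both stated in the context).
   Context: $\mathbb{N}$ denotes the positive integers and $\log$ the natural logarithm. For $n\in\mathbb{N}$, $\omega(n)$ is the number of distinct prime divisors of $n$ and $\gamma(n):=\prod_{p\mid n}p$ is the product of the distinct primes dividing $n$ (so $\gamma(1)=1$). Define $$H(n):=\frac{\gamma(n)}{(\log\gamma(n))^{\omega(n)}}\qquad(n\in\mathbb{N}),$$ with the convention $0^0=1$, so that $H(1)=1$. Conjecture 1 is the statement: for every $\epsilon>0$ there exists a constant $C(\epsilon)$ such that for all $(a,b,c)\in\mathbb{N}^3$ with $\gcd(a,b,c)=1$ and $a+b=c$, one has $c<C(\epsilon)\,H(abc)^{1+\epsilon}$. The $abc$ conjecture is the statement: for every $\epsilon>0$ there exists a constant $C(\epsilon)$ such that for all $(a,b,c)\in\mathbb{N}^3$ with $\gcd(a,b,c)=1$ and $a+b=c$, one has $c<C(\epsilon)\,\gamma(abc)^{1+\epsilon}$. -}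

module Defs where

open import Data.Nat as ℕ using (ℕ; zero; suc; z≤n; s≤s)
import Data.Nat.Properties as ℕ
open import Data.Nat.Divisibility using (_∣?_)
open import Data.Nat.GCD using (gcd)
open import Data.Nat.Primality using (Prime; prime?; prime⇒nonTrivial)
import Data.Integer as ℤ
import Data.Integer.Properties as ℤ
open import Data.Rational as ℚ using (ℚ; 0ℚ; 1ℚ; ½; ∣_∣; *≤*)
import Data.Rational.Properties as ℚ
import Data.Rational.Unnormalised as ℚᵘ
import Data.Rational.Unnormalised.Properties as ℚᵘ
open import Data.Rational.Solver using (module +-*-Solver)
open import Data.List using (List; []; _∷_; filter; upTo; length)
open import Data.Nat.ListAction using (product)
open import Data.List.Relation.Unary.All as All using (All; []; _∷_)
open import Data.List.Relation.Unary.All.Properties using (all-filter)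
open import Data.Product using (_×_; _,_; proj₁; proj₂; ∃-syntax)
open import Data.Sum using (inj₁; inj₂)
open import Relation.Nullary.Decidable using (_×-dec_)
open import Relation.Binary.PropositionalEquality
  using (_≡_; _≢_; refl; sym; trans; cong; cong₂; subst; subst₂; module ≡-Reasoning)
open import Algebra.Definitions.RawSemiring ℚ.+-*-rawSemiring using () renaming (_^_ to infixr 8 _^ℚ_)
open import Algebra.Bundles using (CommutativeRing)
open import Algebra.Properties.CommutativeSemiring.Exp
  (CommutativeRing.commutativeSemiring ℚ.+-*-commutativeRing)
  using () renaming (^-distrib-* to ^ℚ-distrib-*)
open +-*-Solver using (solve; _:=_; _:+_; _:*_; _:-_; :-_; con)

fromℕℚ : ℕ → ℚ
fromℕℚ n = ℤ.+ n ℚ./ 1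

toℚᵘ-/ : ∀ i n .{{_ : ℕ.NonZero n}} → ℚ.toℚᵘ (i ℚ./ n) ℚᵘ.≃ (i ℚᵘ./ n)
toℚᵘ-/ i (suc n) = ℚ.toℚᵘ-fromℚᵘ (ℚᵘ.mkℚᵘ i n)

fromℕℚ-mono : ∀ {m n} → m ℕ.≤ n → fromℕℚ m ℚ.≤ fromℕℚ n
fromℕℚ-mono {m} {n} m≤n = ℚ.toℚᵘ-cancel-≤
  (ℚᵘ.≤-respˡ-≃ (ℚᵘ.≃-sym (toℚᵘ-/ (ℤ.+ m) 1))
    (ℚᵘ.≤-respʳ-≃ (ℚᵘ.≃-sym (toℚᵘ-/ (ℤ.+ n) 1))
      (ℚᵘ.*≤* (ℤ.*-monoʳ-≤-nonNeg (ℤ.+ 1) (ℤ.+≤+ m≤n)))))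

fromℕℚ-suc : ∀ n → fromℕℚ (suc n) ≡ 1ℚ ℚ.+ fromℕℚ n
fromℕℚ-suc n = ℚ.toℚᵘ-injective
  (ℚᵘ.≃-trans (toℚᵘ-/ (ℤ.+ suc n) 1)
    (ℚᵘ.≃-trans (ℚᵘ.*≡* (cong (λ k → (ℤ.+ 1 ℤ.+ k) ℤ.* ℤ.+ 1) (sym (ℤ.*-identityʳ (ℤ.+ n)))))
      (ℚᵘ.≃-trans (ℚᵘ.+-congʳ (ℚ.toℚᵘ 1ℚ) (ℚᵘ.≃-sym (toℚᵘ-/ (ℤ.+ n) 1)))
        (ℚᵘ.≃-sym (ℚ.toℚᵘ-homo-+ 1ℚ (fromℕℚ n))))))

fromℕℚ-* : ∀ m n → fromℕℚ (m ℕ.* n) ≡ fromℕℚ m ℚ.* fromℕℚ n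
fromℕℚ-* zero n = sym (ℚ.*-zeroˡ (fromℕℚ n))
fromℕℚ-* (suc m) n = begin
  fromℕℚ (n ℕ.+ m ℕ.* n)                 ≡⟨ add n (m ℕ.* n) ⟩
  fromℕℚ n ℚ.+ fromℕℚ (m ℕ.* n)          ≡⟨ cong (fromℕℚ n ℚ.+_) (fromℕℚ-* m n) ⟩
  fromℕℚ n ℚ.+ fromℕℚ m ℚ.* fromℕℚ n
    ≡⟨ solve 2 (λ a b → b :+ a :* b := (con 1ℚ :+ a) :* b) refl (fromℕℚ m) (fromℕℚ n) ⟩
  (1ℚ ℚ.+ fromℕℚ m) ℚ.* fromℕℚ n         ≡⟨ cong (ℚ._* fromℕℚ n) (sym (fromℕℚ-suc m)) ⟩
  fromℕℚ (suc m) ℚ.* fromℕℚ n            ∎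
  where
  open ≡-Reasoning
  add : ∀ a b → fromℕℚ (a ℕ.+ b) ≡ fromℕℚ a ℚ.+ fromℕℚ b
  add zero b = sym (ℚ.+-identityˡ _)
  add (suc a) b = trans (fromℕℚ-suc (a ℕ.+ b))
    (trans (cong (1ℚ ℚ.+_) (add a b))
      (trans (sym (ℚ.+-assoc 1ℚ (fromℕℚ a) (fromℕℚ b)))
        (cong (ℚ._+ fromℕℚ b) (sym (fromℕℚ-suc a)))))

fromℕℚ-^ : ∀ a n → fromℕℚ (a ℕ.^ n) ≡ fromℕℚ a ^ℚ n
fromℕℚ-^ a zero = refl
fromℕℚ-^ a (suc n) = trans (fromℕℚ-* a (a ℕ.^ n)) (cong (fromℕℚ a ℚ.*_) (fromℕℚ-^ a n))

0≤fromℕℚ : ∀ n → 0ℚ ℚ.≤ fromℕℚ n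
0≤fromℕℚ n = fromℕℚ-mono {0} {n} z≤n

fraction-* : ∀ m n .{{_ : ℕ.NonZero n}} → fromℕℚ n ℚ.* (ℤ.+ m ℚ./ n) ≡ fromℕℚ m
fraction-* m n@(suc k) = ℚ.toℚᵘ-injective
  (ℚᵘ.≃-trans (ℚ.toℚᵘ-homo-* (fromℕℚ n) (ℤ.+ m ℚ./ n))
    (ℚᵘ.≃-trans (ℚᵘ.*-cong (toℚᵘ-/ (ℤ.+ n) 1) (toℚᵘ-/ (ℤ.+ m) n))
      (ℚᵘ.≃-trans (ℚᵘ.*≡* eq) (ℚᵘ.≃-sym (toℚᵘ-/ (ℤ.+ m) 1)))))
  where
  eq : (ℤ.+ n ℤ.* ℤ.+ m) ℤ.* ℤ.+ 1 ≡ ℤ.+ m ℤ.* ℤ.+ (1 ℕ.* n)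
  eq = trans (ℤ.*-identityʳ _) (trans (ℤ.*-comm (ℤ.+ n) (ℤ.+ m))
         (cong (λ j → ℤ.+ m ℤ.* ℤ.+ j) (sym (ℕ.*-identityˡ n))))

*-mono-≤ˡ : ∀ {r p q} → 0ℚ ℚ.≤ r → p ℚ.≤ q → r ℚ.* p ℚ.≤ r ℚ.* q
*-mono-≤ˡ {r} 0≤r = ℚ.*-monoˡ-≤-nonNeg r {{ℚ.nonNegative 0≤r}}

*-mono-≤ʳ : ∀ {r p q} → 0ℚ ℚ.≤ r → p ℚ.≤ q → p ℚ.* r ℚ.≤ q ℚ.* r
*-mono-≤ʳ {r} 0≤r = ℚ.*-monoʳ-≤-nonNeg r {{ℚ.nonNegative 0≤r}}

*-mono-≤ : ∀ {p q r s} → 0ℚ ℚ.≤ q → 0ℚ ℚ.≤ r → p ℚ.≤ q → r ℚ.≤ s → p ℚ.* r ℚ.≤ q ℚ.* s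
*-mono-≤ 0≤q 0≤r p≤q r≤s = ℚ.≤-trans (*-mono-≤ʳ 0≤r p≤q) (*-mono-≤ˡ 0≤q r≤s)

0≤* : ∀ {p q} → 0ℚ ℚ.≤ p → 0ℚ ℚ.≤ q → 0ℚ ℚ.≤ p ℚ.* q
0≤* {p} {q} 0≤p 0≤q = subst (ℚ._≤ p ℚ.* q) (ℚ.*-zeroʳ p) (*-mono-≤ˡ 0≤p 0≤q)

0<* : ∀ {p q} → 0ℚ ℚ.< p → 0ℚ ℚ.< q → 0ℚ ℚ.< p ℚ.* q
0<* {p} {q} 0<p 0<q =
  subst (ℚ._< p ℚ.* q) (ℚ.*-zeroʳ p) (ℚ.*-monoʳ-<-pos p {{ℚ.positive 0<p}} 0<q)

0<+ : ∀ {p q} → 0ℚ ℚ.< p → 0ℚ ℚ.≤ q → 0ℚ ℚ.< p ℚ.+ q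
0<+ 0<p 0≤q = ℚ.+-mono-<-≤ 0<p 0≤q

0<1 : 0ℚ ℚ.< 1ℚ
0<1 = ℚ.positive⁻¹ 1ℚ

0<2 : 0ℚ ℚ.< 1ℚ ℚ.+ 1ℚ
0<2 = ℚ.positive⁻¹ _

p≤q⇒0≤q-p : ∀ {p q} → p ℚ.≤ q → 0ℚ ℚ.≤ q ℚ.- p
p≤q⇒0≤q-p {p} {q} p≤q = subst (ℚ._≤ q ℚ.- p) (ℚ.+-inverseʳ p) (ℚ.+-monoˡ-≤ (ℚ.- p) p≤q)

0≤q-p⇒p≤q : ∀ {p q} → 0ℚ ℚ.≤ q ℚ.- p → p ℚ.≤ q
0≤q-p⇒p≤q {p} {q} h = subst₂ ℚ._≤_ (ℚ.+-identityˡ p)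
  (solve 2 (λ p q → q :- p :+ p := q) refl p q) (ℚ.+-monoˡ-≤ p h)

∣p∣≤ : ∀ {p q} → p ℚ.≤ q → ℚ.- p ℚ.≤ q → ∣ p ∣ ℚ.≤ q
∣p∣≤ {p} {q} p≤q -p≤q with ℚ.∣p∣≡p∨∣p∣≡-p p
... | inj₁ eq = subst (ℚ._≤ q) (sym eq) p≤q
... | inj₂ eq = subst (ℚ._≤ q) (sym eq) -p≤q

p≤∣p∣ : ∀ p → p ℚ.≤ ∣ p ∣
p≤∣p∣ p with ℚ.≤-total 0ℚ p
... | inj₁ 0≤p = ℚ.≤-reflexive (sym (ℚ.0≤p⇒∣p∣≡p 0≤p))
... | inj₂ p≤0 = ℚ.≤-trans p≤0 (ℚ.0≤∣p∣ p)

∣p-q∣≡∣q-p∣ : ∀ p q → ∣ p ℚ.- q ∣ ≡ ∣ q ℚ.- p ∣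
∣p-q∣≡∣q-p∣ p q =
  trans (cong ∣_∣ (solve 2 (λ p q → p :- q := :- (q :- p)) refl p q)) (ℚ.∣-p∣≡∣p∣ (q ℚ.- p))

triangle : ∀ p q r → ∣ p ℚ.- r ∣ ℚ.≤ ∣ p ℚ.- q ∣ ℚ.+ ∣ q ℚ.- r ∣
triangle p q r = subst (λ z → ∣ z ∣ ℚ.≤ ∣ p ℚ.- q ∣ ℚ.+ ∣ q ℚ.- r ∣)
  (solve 3 (λ p q r → (p :- q) :+ (q :- r) := p :- r) refl p q r)
  (ℚ.∣p+q∣≤∣p∣+∣q∣ (p ℚ.- q) (q ℚ.- r))

recip : (p : ℚ) → .(0ℚ ℚ.< p) → ℚ
recip p 0<p = (ℚ.1/ p) {{ℚ.>-nonZero 0<p}}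

recip-inverseʳ : ∀ p .(0<p : 0ℚ ℚ.< p) → p ℚ.* recip p 0<p ≡ 1ℚ
recip-inverseʳ p 0<p = ℚ.*-inverseʳ p {{ℚ.>-nonZero 0<p}}

0<recip : ∀ p (0<p : 0ℚ ℚ.< p) → 0ℚ ℚ.< recip p 0<p
0<recip p 0<p = ℚ.positive⁻¹ _ {{ℚ.1/pos⇒pos p {{ℚ.positive 0<p}}}}

*-cancel-≤ : ∀ {r p q} → 0ℚ ℚ.< r → r ℚ.* p ℚ.≤ r ℚ.* q → p ℚ.≤ q
*-cancel-≤ {r} 0<r = ℚ.*-cancelˡ-≤-pos r {{ℚ.positive 0<r}}

archimedean : ∀ p → ∃[ n ] p ℚ.≤ fromℕℚ n
archimedean p@record{} = ℤ.∣ ℚ.↥ p ∣ , ℚ.toℚᵘ-cancel-≤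
  (ℚᵘ.≤-respʳ-≃ (ℚᵘ.≃-sym (toℚᵘ-/ (ℤ.+ ℤ.∣ ℚ.↥ p ∣) 1)) (ℚᵘ.*≤* (bound (ℚ.↥ p) (ℚ.denominator-1 p))))
  where
  bound : ∀ i d → i ℤ.* ℤ.+ 1 ℤ.≤ ℤ.+ ℤ.∣ i ∣ ℤ.* ℤ.+ suc d
  bound (ℤ.+ n) d = subst₂ ℤ._≤_ (ℤ.pos-* n 1) (ℤ.pos-* n (suc d))
    (ℤ.+≤+ (ℕ.*-monoʳ-≤ n (s≤s z≤n)))
  bound ℤ.-[1+ n ] d = ℤ.-≤+

0≤^ : ∀ {p} n → 0ℚ ℚ.≤ p → 0ℚ ℚ.≤ p ^ℚ n
0≤^ zero 0≤p = ℚ.<⇒≤ 0<1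
0≤^ (suc n) 0≤p = 0≤* 0≤p (0≤^ n 0≤p)

^-mono-≤ : ∀ {p q} n → 0ℚ ℚ.≤ p → p ℚ.≤ q → p ^ℚ n ℚ.≤ q ^ℚ n
^-mono-≤ zero 0≤p p≤q = ℚ.≤-refl
^-mono-≤ (suc n) 0≤p p≤q =
  *-mono-≤ (ℚ.≤-trans 0≤p p≤q) (0≤^ n 0≤p) p≤q (^-mono-≤ n 0≤p p≤q)

∣p^n∣≡∣p∣^n : ∀ p n → ∣ p ^ℚ n ∣ ≡ ∣ p ∣ ^ℚ n
∣p^n∣≡∣p∣^n p zero = refl
∣p^n∣≡∣p∣^n p (suc n) =
  trans (ℚ.∣p*q∣≡∣p∣*∣q∣ p (p ^ℚ n)) (cong (∣ p ∣ ℚ.*_) (∣p^n∣≡∣p∣^n p n))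

p^n≤1 : ∀ {p} n → 0ℚ ℚ.≤ p → p ℚ.≤ 1ℚ → p ^ℚ n ℚ.≤ 1ℚ
p^n≤1 zero 0≤p p≤1 = ℚ.≤-refl
p^n≤1 (suc n) 0≤p p≤1 = *-mono-≤ {s = 1ℚ} (ℚ.<⇒≤ 0<1) (0≤^ n 0≤p) p≤1 (p^n≤1 n 0≤p p≤1)

bernoulli : ∀ s → 0ℚ ℚ.≤ s → s ℚ.≤ 1ℚ → ∀ n →
            (1ℚ ℚ.- s) ^ℚ n ℚ.* (1ℚ ℚ.+ fromℕℚ n ℚ.* s) ℚ.≤ 1ℚ
bernoulli s 0≤s s≤1 zero = ℚ.≤-reflexive
  (solve 1 (λ s → con 1ℚ :* (con 1ℚ :+ con 0ℚ :* s) := con 1ℚ) refl s)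
bernoulli s 0≤s s≤1 (suc n) = begin
  q ℚ.* q ^ℚ n ℚ.* (1ℚ ℚ.+ fromℕℚ (suc n) ℚ.* s)
    ≡⟨ cong (λ z → q ℚ.* q ^ℚ n ℚ.* (1ℚ ℚ.+ z ℚ.* s)) (fromℕℚ-suc n) ⟩
  q ℚ.* q ^ℚ n ℚ.* (1ℚ ℚ.+ (1ℚ ℚ.+ fromℕℚ n) ℚ.* s)
    ≡⟨ solve 3 (λ s a x → (con 1ℚ :- s) :* a :* (con 1ℚ :+ (con 1ℚ :+ x) :* s)
               := a :* (con 1ℚ :+ x :* s) :- a :* ((con 1ℚ :+ x) :* (s :* s)))
             refl s (q ^ℚ n) (fromℕℚ n) ⟩
  q ^ℚ n ℚ.* (1ℚ ℚ.+ fromℕℚ n ℚ.* s) ℚ.- e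
    ≤⟨ ℚ.+-monoʳ-≤ (q ^ℚ n ℚ.* (1ℚ ℚ.+ fromℕℚ n ℚ.* s)) (ℚ.neg-antimono-≤ 0≤e) ⟩
  q ^ℚ n ℚ.* (1ℚ ℚ.+ fromℕℚ n ℚ.* s) ℚ.+ 0ℚ
    ≡⟨ ℚ.+-identityʳ _ ⟩
  q ^ℚ n ℚ.* (1ℚ ℚ.+ fromℕℚ n ℚ.* s)
    ≤⟨ bernoulli s 0≤s s≤1 n ⟩
  1ℚ ∎
  where
  open ℚ.≤-Reasoning
  q = 1ℚ ℚ.- s
  e = q ^ℚ n ℚ.* ((1ℚ ℚ.+ fromℕℚ n) ℚ.* (s ℚ.* s))
  0≤e : 0ℚ ℚ.≤ e
  0≤e = 0≤* (0≤^ n (p≤q⇒0≤q-p s≤1))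
            (0≤* (subst (0ℚ ℚ.≤_) (fromℕℚ-suc n) (0≤fromℕℚ (suc n))) (0≤* 0≤s 0≤s))

a^k≤a^a*k! : ∀ a .{{_ : ℕ.NonZero a}} k → a ℕ.^ k ℕ.≤ a ℕ.^ a ℕ.* k ℕ.!
a^k≤a^a*k! a k with ℕ.≤-total k a
... | inj₁ k≤a = ℕ.≤-trans (ℕ.^-monoʳ-≤ a k≤a) (ℕ.m≤m*n (a ℕ.^ a) (k ℕ.!) {{k ℕ.!≢0}})
... | inj₂ a≤k = subst (λ k → a ℕ.^ k ℕ.≤ a ℕ.^ a ℕ.* k ℕ.!) (ℕ.m+[n∸m]≡n a≤k) (go (k ℕ.∸ a))
  where
  go : ∀ j → a ℕ.^ (a ℕ.+ j) ℕ.≤ a ℕ.^ a ℕ.* (a ℕ.+ j) ℕ.!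
  go zero = subst (λ k → a ℕ.^ k ℕ.≤ a ℕ.^ a ℕ.* k ℕ.!) (sym (ℕ.+-identityʳ a))
    (ℕ.m≤m*n (a ℕ.^ a) (a ℕ.!) {{a ℕ.!≢0}})
  go (suc j) rewrite ℕ.+-suc a j = begin
    a ℕ.* a ℕ.^ (a ℕ.+ j)
      ≤⟨ ℕ.*-mono-≤ (ℕ.≤-trans (ℕ.m≤m+n a j) (ℕ.n≤1+n _)) (go j) ⟩
    suc (a ℕ.+ j) ℕ.* (a ℕ.^ a ℕ.* (a ℕ.+ j) ℕ.!)
      ≡⟨ ℕ.*-assoc (suc (a ℕ.+ j)) (a ℕ.^ a) _ ⟨
    suc (a ℕ.+ j) ℕ.* a ℕ.^ a ℕ.* (a ℕ.+ j) ℕ.!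
      ≡⟨ cong (ℕ._* (a ℕ.+ j) ℕ.!) (ℕ.*-comm (suc (a ℕ.+ j)) (a ℕ.^ a)) ⟩
    a ℕ.^ a ℕ.* suc (a ℕ.+ j) ℕ.* (a ℕ.+ j) ℕ.!
      ≡⟨ ℕ.*-assoc (a ℕ.^ a) _ _ ⟩
    a ℕ.^ a ℕ.* (suc (a ℕ.+ j) ℕ.* (a ℕ.+ j) ℕ.!) ∎
    where open ℕ.≤-Reasoning

record IsCauchy (f : ℕ → ℚ) : Set where
  constructor mkCauchy
  field
    within : ∀ δ → 0ℚ ℚ.< δ →
      ∃[ N ] (∀ m n → N ℕ.≤ m → N ℕ.≤ n → ∣ f m ℚ.- f n ∣ ℚ.≤ δ)

open IsCauchy public

record ℝ : Set where
  constructor mkℝ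
  field
    approx : ℕ → ℚ
    cauchy : IsCauchy approx

open ℝ public

infix 4 _<_

record _<_ (x y : ℝ) : Set where
  constructor mk<
  field
    gap   : ℚ
    gap>0 : 0ℚ ℚ.< gap
    from  : ℕ
    bound : ∀ n → from ℕ.≤ n → approx x n ℚ.+ gap ℚ.≤ approx y n

open _<_ public

abstract
  rescale : ∀ {f} K → 0ℚ ℚ.< K →
            (∀ δ → 0ℚ ℚ.< δ → ∃[ N ] (∀ m n → N ℕ.≤ m → N ℕ.≤ n → ∣ f m ℚ.- f n ∣ ℚ.≤ K ℚ.* δ)) →
            IsCauchy f
  rescale {f} K 0<K h = mkCauchy λ δ 0<δ →
      let N , p = h (recip K 0<K ℚ.* δ) (0<* (0<recip K 0<K) 0<δ) in
      N , λ m n N≤m N≤n → subst (∣ f m ℚ.- f n ∣ ℚ.≤_) (eq δ) (p m n N≤m N≤n)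
    where
    eq : ∀ δ → K ℚ.* (recip K 0<K ℚ.* δ) ≡ δ
    eq δ = trans (sym (ℚ.*-assoc K _ δ)) (trans (cong (ℚ._* δ) (recip-inverseʳ K 0<K)) (ℚ.*-identityˡ δ))

  const-cauchy : ∀ q → IsCauchy (λ _ → q)
  const-cauchy q = mkCauchy λ δ 0<δ → 0 , λ _ _ _ _ → subst (ℚ._≤ δ) (sym (cong ∣_∣ (ℚ.+-inverseʳ q))) (ℚ.<⇒≤ 0<δ)

  bounded : ∀ {f} → IsCauchy f → ∃[ B ] (0ℚ ℚ.< B × (∀ n → ∣ f n ∣ ℚ.≤ B))
  bounded {f} c with within c 1ℚ 0<1
  ... | N , p = 1ℚ ℚ.+ prefix N , 0<+ 0<1 (0≤prefix N) , below
    where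
    prefix : ℕ → ℚ
    prefix zero = ∣ f 0 ∣
    prefix (suc n) = ∣ f (suc n) ∣ ℚ.+ prefix n

    0≤prefix : ∀ n → 0ℚ ℚ.≤ prefix n
    0≤prefix zero = ℚ.0≤∣p∣ (f 0)
    0≤prefix (suc n) = ℚ.+-mono-≤ (ℚ.0≤∣p∣ (f (suc n))) (0≤prefix n)

    last≤prefix : ∀ n → ∣ f n ∣ ℚ.≤ prefix n
    last≤prefix zero = ℚ.≤-refl
    last≤prefix (suc n) = subst (ℚ._≤ prefix (suc n)) (ℚ.+-identityʳ _)
      (ℚ.+-monoʳ-≤ ∣ f (suc n) ∣ (0≤prefix n))

    prefix-mono : ∀ k j → prefix k ℚ.≤ prefix (j ℕ.+ k)
    prefix-mono k zero = ℚ.≤-refl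
    prefix-mono k (suc j) = ℚ.≤-trans (prefix-mono k j)
      (subst (ℚ._≤ prefix (suc (j ℕ.+ k))) (ℚ.+-identityˡ _)
        (ℚ.+-monoˡ-≤ (prefix (j ℕ.+ k)) (ℚ.0≤∣p∣ (f (suc (j ℕ.+ k))))))

    below : ∀ n → ∣ f n ∣ ℚ.≤ 1ℚ ℚ.+ prefix N
    below n with ℕ.≤-total n N
    ... | inj₁ n≤N = ℚ.≤-trans (last≤prefix n) (ℚ.≤-trans
      (subst (λ k → prefix n ℚ.≤ prefix k) (ℕ.m∸n+n≡m n≤N) (prefix-mono n (N ℕ.∸ n)))
      (subst (ℚ._≤ 1ℚ ℚ.+ prefix N) (ℚ.+-identityˡ _) (ℚ.+-monoˡ-≤ (prefix N) (ℚ.<⇒≤ 0<1))))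
    ... | inj₂ N≤n = begin
      ∣ f n ∣                        ≡⟨ cong ∣_∣ (solve 2 (λ a b → a := (a :- b) :+ b) refl (f n) (f N)) ⟩
      ∣ (f n ℚ.- f N) ℚ.+ f N ∣      ≤⟨ ℚ.∣p+q∣≤∣p∣+∣q∣ (f n ℚ.- f N) (f N) ⟩
      ∣ f n ℚ.- f N ∣ ℚ.+ ∣ f N ∣    ≤⟨ ℚ.+-mono-≤ (p n N N≤n ℕ.≤-refl) (last≤prefix N) ⟩
      1ℚ ℚ.+ prefix N                ∎
      where open ℚ.≤-Reasoning

  neg-cauchy : ∀ {f} → IsCauchy f → IsCauchy (λ n → ℚ.- f n)
  neg-cauchy {f} c = mkCauchy λ δ 0<δ →
    let N , p = within c δ 0<δ in
    N , λ m n ≤m ≤n → subst (ℚ._≤ δ)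
      (cong ∣_∣ (solve 2 (λ a b → b :- a := :- a :- :- b) refl (f m) (f n))) (p n m ≤n ≤m)

  +-cauchy : ∀ {f g} → IsCauchy f → IsCauchy g → IsCauchy (λ n → f n ℚ.+ g n)
  +-cauchy {f} {g} cf cg = rescale (1ℚ ℚ.+ 1ℚ) 0<2 λ δ 0<δ →
    let M , p = within cf δ 0<δ ; N , q = within cg δ 0<δ in
    M ℕ.⊔ N , λ m n ≤m ≤n → begin
      ∣ (f m ℚ.+ g m) ℚ.- (f n ℚ.+ g n) ∣
        ≡⟨ cong ∣_∣ (solve 4 (λ a b c d → (a :+ b) :- (c :+ d) := (a :- c) :+ (b :- d)) refl
                      (f m) (g m) (f n) (g n)) ⟩
      ∣ (f m ℚ.- f n) ℚ.+ (g m ℚ.- g n) ∣     ≤⟨ ℚ.∣p+q∣≤∣p∣+∣q∣ (f m ℚ.- f n) (g m ℚ.- g n) ⟩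
      ∣ f m ℚ.- f n ∣ ℚ.+ ∣ g m ℚ.- g n ∣
        ≤⟨ ℚ.+-mono-≤ (p m n (ℕ.m⊔n≤o⇒m≤o M N ≤m) (ℕ.m⊔n≤o⇒m≤o M N ≤n))
                      (q m n (ℕ.m⊔n≤o⇒n≤o M N ≤m) (ℕ.m⊔n≤o⇒n≤o M N ≤n)) ⟩
      δ ℚ.+ δ                                 ≡⟨ solve 1 (λ d → d :+ d := (con 1ℚ :+ con 1ℚ) :* d) refl δ ⟩
      (1ℚ ℚ.+ 1ℚ) ℚ.* δ                       ∎
    where open ℚ.≤-Reasoning

  *-cauchy : ∀ {f g} → IsCauchy f → IsCauchy g → IsCauchy (λ n → f n ℚ.* g n)
  *-cauchy {f} {g} cf cg =
    let A , 0<A , f≤A = bounded cf ; B , 0<B , g≤B = bounded cg in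
    rescale (A ℚ.+ B) (0<+ 0<A (ℚ.<⇒≤ 0<B)) λ δ 0<δ →
    let M , p = within cf δ 0<δ ; N , q = within cg δ 0<δ in
    M ℕ.⊔ N , λ m n ≤m ≤n → begin
      ∣ f m ℚ.* g m ℚ.- f n ℚ.* g n ∣
        ≡⟨ cong ∣_∣ (solve 4 (λ a b c d → a :* b :- c :* d := a :* (b :- d) :+ d :* (a :- c)) refl
                      (f m) (g m) (f n) (g n)) ⟩
      ∣ f m ℚ.* (g m ℚ.- g n) ℚ.+ g n ℚ.* (f m ℚ.- f n) ∣
        ≤⟨ ℚ.∣p+q∣≤∣p∣+∣q∣ (f m ℚ.* (g m ℚ.- g n)) (g n ℚ.* (f m ℚ.- f n)) ⟩
      ∣ f m ℚ.* (g m ℚ.- g n) ∣ ℚ.+ ∣ g n ℚ.* (f m ℚ.- f n) ∣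
        ≡⟨ cong₂ ℚ._+_ (ℚ.∣p*q∣≡∣p∣*∣q∣ (f m) _) (ℚ.∣p*q∣≡∣p∣*∣q∣ (g n) _) ⟩
      ∣ f m ∣ ℚ.* ∣ g m ℚ.- g n ∣ ℚ.+ ∣ g n ∣ ℚ.* ∣ f m ℚ.- f n ∣
        ≤⟨ ℚ.+-mono-≤
             (*-mono-≤ (ℚ.<⇒≤ 0<A) (ℚ.0≤∣p∣ _) (f≤A m)
               (q m n (ℕ.m⊔n≤o⇒n≤o M N ≤m) (ℕ.m⊔n≤o⇒n≤o M N ≤n)))
             (*-mono-≤ (ℚ.<⇒≤ 0<B) (ℚ.0≤∣p∣ _) (g≤B n)
               (p m n (ℕ.m⊔n≤o⇒m≤o M N ≤m) (ℕ.m⊔n≤o⇒m≤o M N ≤n))) ⟩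
      A ℚ.* δ ℚ.+ B ℚ.* δ     ≡⟨ ℚ.*-distribʳ-+ δ A B ⟨
      (A ℚ.+ B) ℚ.* δ         ∎
    where open ℚ.≤-Reasoning

  ^-cauchy : ∀ {f} k → IsCauchy f → IsCauchy (λ n → f n ^ℚ k)
  ^-cauchy zero c = const-cauchy 1ℚ
  ^-cauchy (suc k) c = *-cauchy c (^-cauchy k c)

0<δ⊔ : ∀ {δ} q → 0ℚ ℚ.< δ → 0ℚ ℚ.< δ ℚ.⊔ q
0<δ⊔ {δ} q 0<δ = ℚ.<-≤-trans 0<δ (ℚ.p≤p⊔q δ q)

⊔-nonexpansive : ∀ δ p q → (δ ℚ.⊔ p) ℚ.- (δ ℚ.⊔ q) ℚ.≤ ∣ p ℚ.- q ∣
⊔-nonexpansive δ p q = 0≤q-p⇒p≤q (subst (0ℚ ℚ.≤_)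
    (solve 3 (λ a b c → (a :+ b) :- c := a :- (c :- b)) refl ∣ p ℚ.- q ∣ (δ ℚ.⊔ q) (δ ℚ.⊔ p))
    (p≤q⇒0≤q-p (ℚ.⊔-lub δ≤ p≤)))
  where
  δ≤ : δ ℚ.≤ ∣ p ℚ.- q ∣ ℚ.+ (δ ℚ.⊔ q)
  δ≤ = subst (ℚ._≤ ∣ p ℚ.- q ∣ ℚ.+ (δ ℚ.⊔ q)) (ℚ.+-identityˡ δ) (ℚ.+-mono-≤ (ℚ.0≤∣p∣ (p ℚ.- q)) (ℚ.p≤p⊔q δ q))
  p≤ : p ℚ.≤ ∣ p ℚ.- q ∣ ℚ.+ (δ ℚ.⊔ q)
  p≤ = subst (ℚ._≤ ∣ p ℚ.- q ∣ ℚ.+ (δ ℚ.⊔ q)) (solve 2 (λ p q → p :- q :+ q := p) refl p q)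
         (ℚ.+-mono-≤ (p≤∣p∣ (p ℚ.- q)) (ℚ.p≤q⊔p δ q))

recip-cauchy : ∀ {f δ} → (0<δ : 0ℚ ℚ.< δ) → IsCauchy f →
               IsCauchy (λ n → recip (δ ℚ.⊔ f n) (0<δ⊔ (f n) 0<δ))
recip-cauchy {f} {δ} 0<δ cf = rescale (r ℚ.* r) (0<* 0<r 0<r) λ ε 0<ε →
    let N , p = within cf ε 0<ε in
    N , λ m n ≤m ≤n → begin
      ∣ i m ℚ.- i n ∣
        ≡⟨ cong ∣_∣ (diff m n) ⟩
      ∣ i m ℚ.* i n ℚ.* (c n ℚ.- c m) ∣
        ≡⟨ ℚ.∣p*q∣≡∣p∣*∣q∣ (i m ℚ.* i n) _ ⟩
      ∣ i m ℚ.* i n ∣ ℚ.* ∣ c n ℚ.- c m ∣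
        ≡⟨ cong (ℚ._* ∣ c n ℚ.- c m ∣) (ℚ.0≤p⇒∣p∣≡p (0≤* (0≤i m) (0≤i n))) ⟩
      i m ℚ.* i n ℚ.* ∣ c n ℚ.- c m ∣
        ≤⟨ *-mono-≤ (0≤* (ℚ.<⇒≤ 0<r) (ℚ.<⇒≤ 0<r)) (ℚ.0≤∣p∣ _)
             (*-mono-≤ (ℚ.<⇒≤ 0<r) (0≤i n) (i≤r m) (i≤r n))
             (ℚ.≤-trans (close n m) (p n m ≤n ≤m)) ⟩
      r ℚ.* r ℚ.* ε ∎
  where
  open ℚ.≤-Reasoning
  r = recip δ 0<δ
  0<r = 0<recip δ 0<δ
  c i : ℕ → ℚ
  c n = δ ℚ.⊔ f n
  i n = recip (c n) (0<δ⊔ (f n) 0<δ)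
  ci : ∀ n → c n ℚ.* i n ≡ 1ℚ
  ci n = recip-inverseʳ (c n) (0<δ⊔ (f n) 0<δ)
  0≤i : ∀ n → 0ℚ ℚ.≤ i n
  0≤i n = ℚ.<⇒≤ (0<recip (c n) (0<δ⊔ (f n) 0<δ))
  i≤r : ∀ n → i n ℚ.≤ r
  i≤r n = *-cancel-≤ 0<δ (ℚ.≤-trans (*-mono-≤ʳ (0≤i n) (ℚ.p≤p⊔q δ (f n)))
            (ℚ.≤-reflexive (trans (ci n) (sym (recip-inverseʳ δ 0<δ)))))
  diff : ∀ m n → i m ℚ.- i n ≡ i m ℚ.* i n ℚ.* (c n ℚ.- c m)
  diff m n = sym (begin-equality
    i m ℚ.* i n ℚ.* (c n ℚ.- c m)
      ≡⟨ solve 4 (λ a b x y → a :* b :* (y :- x) := a :* (y :* b) :- b :* (x :* a)) refl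
           (i m) (i n) (c m) (c n) ⟩
    i m ℚ.* (c n ℚ.* i n) ℚ.- i n ℚ.* (c m ℚ.* i m)
      ≡⟨ cong₂ (λ u v → i m ℚ.* u ℚ.- i n ℚ.* v) (ci n) (ci m) ⟩
    i m ℚ.* 1ℚ ℚ.- i n ℚ.* 1ℚ
      ≡⟨ cong₂ ℚ._-_ (ℚ.*-identityʳ (i m)) (ℚ.*-identityʳ (i n)) ⟩
    i m ℚ.- i n ∎)
  close : ∀ m n → ∣ c m ℚ.- c n ∣ ℚ.≤ ∣ f m ℚ.- f n ∣
  close m n = ∣p∣≤ (⊔-nonexpansive δ (f m) (f n))
    (subst₂ ℚ._≤_ (solve 2 (λ a b → a :- b := :- (b :- a)) refl (c n) (c m))
      (∣p-q∣≡∣q-p∣ (f n) (f m)) (⊔-nonexpansive δ (f n) (f m)))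

fromℚ : ℚ → ℝ
fromℚ q = mkℝ (λ _ → q) (const-cauchy q)

fromℕ : ℕ → ℝ
fromℕ n = fromℚ (fromℕℚ n)

0ℝ 1ℝ : ℝ
0ℝ = fromℚ 0ℚ
1ℝ = fromℚ 1ℚ

infix  8 -_
infixl 6 _+_ _-_
infixl 7 _*_ _/_[_]
infixr 9 _^_

-_ : ℝ → ℝ
- x = mkℝ (λ n → ℚ.- approx x n) (neg-cauchy (cauchy x))

_+_ : ℝ → ℝ → ℝ
x + y = mkℝ (λ n → approx x n ℚ.+ approx y n) (+-cauchy (cauchy x) (cauchy y))

_-_ : ℝ → ℝ → ℝ
x - y = x + - y

_*_ : ℝ → ℝ → ℝ
x * y = mkℝ (λ n → approx x n ℚ.* approx y n) (*-cauchy (cauchy x) (cauchy y))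

_^_ : ℝ → ℕ → ℝ
x ^ zero = 1ℝ
x ^ suc n = x * x ^ n

-- Eventually gap 0<x ≤ approx x n, so the maximum only alters finitely many
-- approximations, which might otherwise vanish.
inverse : (x : ℝ) → 0ℝ < x → ℝ
inverse x 0<x = mkℝ
  (λ n → recip (gap 0<x ℚ.⊔ approx x n) (0<δ⊔ (approx x n) (gap>0 0<x)))
  (recip-cauchy (gap>0 0<x) (cauchy x))

_/_[_] : (x y : ℝ) → 0ℝ < y → ℝ
x / y [ 0<y ] = x * inverse y 0<y

sum< : ℕ → (ℕ → ℚ) → ℚ
sum< zero    t = 0ℚ
sum< (suc n) t = sum< n t ℚ.+ t n

sum<-cauchy : ∀ K {t : ℕ → ℕ → ℚ} → (∀ k → IsCauchy (t k)) → IsCauchy (λ n → sum< K (λ k → t k n))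
sum<-cauchy zero c = const-cauchy 0ℚ
sum<-cauchy (suc K) c = +-cauchy (sum<-cauchy K c) (c K)

module _ {M s : ℚ} (0≤M : 0ℚ ℚ.≤ M) (0<s : 0ℚ ℚ.< s) (s≤1 : s ℚ.≤ 1ℚ) where
  private
    q = 1ℚ ℚ.- s
    0≤q = p≤q⇒0≤q-p s≤1
    0≤s = ℚ.<⇒≤ 0<s

  tail-telescope : ∀ t K → (∀ k → ∣ t k ∣ ℚ.≤ M ℚ.* q ^ℚ k) → ∀ j →
    s ℚ.* ∣ sum< (j ℕ.+ K) t ℚ.- sum< K t ∣ ℚ.≤ M ℚ.* (q ^ℚ K ℚ.- q ^ℚ (j ℕ.+ K))
  tail-telescope t K t≤ zero = ℚ.≤-reflexive (begin
    s ℚ.* ∣ sum< K t ℚ.- sum< K t ∣  ≡⟨ cong (λ z → s ℚ.* ∣ z ∣) (ℚ.+-inverseʳ (sum< K t)) ⟩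
    s ℚ.* 0ℚ                         ≡⟨ solve 3 (λ s m a → s :* con 0ℚ := m :* (a :- a)) refl s M (q ^ℚ K) ⟩
    M ℚ.* (q ^ℚ K ℚ.- q ^ℚ K)        ∎)
    where open ≡-Reasoning
  tail-telescope t K t≤ (suc j) = begin
    s ℚ.* ∣ S′ ℚ.+ t J ℚ.- S ∣
      ≡⟨ cong (λ z → s ℚ.* ∣ z ∣) (solve 3 (λ a b c → a :+ b :- c := (a :- c) :+ b) refl S′ (t J) S) ⟩
    s ℚ.* ∣ (S′ ℚ.- S) ℚ.+ t J ∣
      ≤⟨ *-mono-≤ˡ 0≤s (ℚ.∣p+q∣≤∣p∣+∣q∣ (S′ ℚ.- S) (t J)) ⟩
    s ℚ.* (∣ S′ ℚ.- S ∣ ℚ.+ ∣ t J ∣)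
      ≡⟨ ℚ.*-distribˡ-+ s _ _ ⟩
    s ℚ.* ∣ S′ ℚ.- S ∣ ℚ.+ s ℚ.* ∣ t J ∣
      ≤⟨ ℚ.+-mono-≤ (tail-telescope t K t≤ j) (*-mono-≤ˡ 0≤s (t≤ J)) ⟩
    M ℚ.* (q ^ℚ K ℚ.- q ^ℚ J) ℚ.+ s ℚ.* (M ℚ.* q ^ℚ J)
      ≡⟨ solve 4 (λ s m a b → m :* (a :- b) :+ s :* (m :* b) := m :* (a :- (con 1ℚ :- s) :* b)) refl
           s M (q ^ℚ K) (q ^ℚ J) ⟩
    M ℚ.* (q ^ℚ K ℚ.- q ℚ.* q ^ℚ J) ∎
    where
    open ℚ.≤-Reasoning
    J = j ℕ.+ K
    S = sum< K t
    S′ = sum< J t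

  -- K is chosen with M ≤ K s² δ; Bernoulli's inequality bounds M qᴷ / s by δ.
  tail-small : ∀ {δ} → 0ℚ ℚ.< δ → ∃[ K ] (∀ t → (∀ k → ∣ t k ∣ ℚ.≤ M ℚ.* q ^ℚ k) →
    ∀ n → K ℕ.≤ n → ∣ sum< n t ℚ.- sum< K t ∣ ℚ.≤ δ)
  tail-small {δ} 0<δ = K , λ t t≤ n K≤n →
      subst (λ n → ∣ sum< n t ℚ.- sum< K t ∣ ℚ.≤ δ) (ℕ.m∸n+n≡m K≤n) (small t t≤ (n ℕ.∸ K))
    where
    open ℚ.≤-Reasoning
    ssδ = s ℚ.* s ℚ.* δ
    0<ssδ = 0<* (0<* 0<s 0<s) 0<δ
    arch = archimedean (M ℚ.* recip ssδ 0<ssδ)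
    K = suc (proj₁ arch)
    k̂ = fromℕℚ K
    0<k̂ : 0ℚ ℚ.< k̂
    0<k̂ = subst (0ℚ ℚ.<_) (sym (fromℕℚ-suc (proj₁ arch))) (0<+ 0<1 (0≤fromℕℚ (proj₁ arch)))
    M≤ : M ℚ.≤ k̂ ℚ.* ssδ
    M≤ = begin
      M                                  ≡⟨ ℚ.*-identityʳ M ⟨
      M ℚ.* 1ℚ                           ≡⟨ cong (M ℚ.*_) (recip-inverseʳ ssδ 0<ssδ) ⟨
      M ℚ.* (ssδ ℚ.* recip ssδ 0<ssδ)
        ≡⟨ solve 3 (λ a b c → a :* (b :* c) := a :* c :* b) refl M ssδ (recip ssδ 0<ssδ) ⟩
      M ℚ.* recip ssδ 0<ssδ ℚ.* ssδ
        ≤⟨ *-mono-≤ʳ (ℚ.<⇒≤ 0<ssδ) (ℚ.≤-trans (proj₂ arch) (fromℕℚ-mono (ℕ.n≤1+n (proj₁ arch)))) ⟩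
      k̂ ℚ.* ssδ                          ∎
    small : ∀ t → (∀ k → ∣ t k ∣ ℚ.≤ M ℚ.* q ^ℚ k) → ∀ j →
            ∣ sum< (j ℕ.+ K) t ℚ.- sum< K t ∣ ℚ.≤ δ
    small t t≤ j = *-cancel-≤ (0<* 0<k̂ (0<* 0<s 0<s)) (begin
      k̂ ℚ.* (s ℚ.* s) ℚ.* T
        ≡⟨ solve 3 (λ k s t → k :* (s :* s) :* t := s :* t :* (k :* s)) refl k̂ s T ⟩
      s ℚ.* T ℚ.* (k̂ ℚ.* s)
        ≤⟨ *-mono-≤ˡ (0≤* 0≤s (ℚ.0≤∣p∣ _)) k̂s≤ ⟩
      s ℚ.* T ℚ.* (1ℚ ℚ.+ k̂ ℚ.* s)
        ≤⟨ *-mono-≤ʳ (ℚ.≤-trans (0≤* (ℚ.<⇒≤ 0<k̂) 0≤s) k̂s≤) sT≤ ⟩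
      M ℚ.* q ^ℚ K ℚ.* (1ℚ ℚ.+ k̂ ℚ.* s)
        ≡⟨ ℚ.*-assoc M _ _ ⟩
      M ℚ.* (q ^ℚ K ℚ.* (1ℚ ℚ.+ k̂ ℚ.* s))
        ≤⟨ *-mono-≤ˡ 0≤M (bernoulli s 0≤s s≤1 K) ⟩
      M ℚ.* 1ℚ
        ≡⟨ ℚ.*-identityʳ M ⟩
      M
        ≤⟨ M≤ ⟩
      k̂ ℚ.* (s ℚ.* s ℚ.* δ)
        ≡⟨ ℚ.*-assoc k̂ (s ℚ.* s) δ ⟨
      k̂ ℚ.* (s ℚ.* s) ℚ.* δ ∎)
      where
      T = ∣ sum< (j ℕ.+ K) t ℚ.- sum< K t ∣
      k̂s≤ : k̂ ℚ.* s ℚ.≤ 1ℚ ℚ.+ k̂ ℚ.* s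
      k̂s≤ = subst (ℚ._≤ 1ℚ ℚ.+ k̂ ℚ.* s) (ℚ.+-identityˡ _) (ℚ.+-monoˡ-≤ (k̂ ℚ.* s) (ℚ.<⇒≤ 0<1))
      sT≤ : s ℚ.* T ℚ.≤ M ℚ.* q ^ℚ K
      sT≤ = ℚ.≤-trans (tail-telescope t K t≤ j) (*-mono-≤ˡ 0≤M
        (subst (q ^ℚ K ℚ.- q ^ℚ (j ℕ.+ K) ℚ.≤_) (ℚ.+-identityʳ (q ^ℚ K))
          (ℚ.+-monoʳ-≤ (q ^ℚ K) (ℚ.neg-antimono-≤ (0≤^ (j ℕ.+ K) 0≤q)))))

  series-cauchy : (t : ℕ → ℕ → ℚ) → (∀ k → IsCauchy (t k)) → ∀ N₀ →
    (∀ n → N₀ ℕ.≤ n → ∀ k → ∣ t k n ∣ ℚ.≤ M ℚ.* q ^ℚ k) →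
    IsCauchy (λ n → sum< n (λ k → t k n))
  series-cauchy t c N₀ t≤ = rescale (1ℚ ℚ.+ 1ℚ ℚ.+ 1ℚ) (ℚ.positive⁻¹ _) λ δ 0<δ →
    let K , tail = tail-small 0<δ
        N₁ , p = within (sum<-cauchy K c) δ 0<δ
        S = λ n → sum< n (λ k → t k n)
        P = λ n → sum< K (λ k → t k n)
        near : ∀ n → N₀ ℕ.⊔ (N₁ ℕ.⊔ K) ℕ.≤ n → ∣ S n ℚ.- P n ∣ ℚ.≤ δ
        near = λ n ≤n → tail (λ k → t k n) (t≤ n (ℕ.m⊔n≤o⇒m≤o N₀ _ ≤n)) n
                 (ℕ.m⊔n≤o⇒n≤o N₁ K (ℕ.m⊔n≤o⇒n≤o N₀ _ ≤n))
        N₁≤ : ∀ n → N₀ ℕ.⊔ (N₁ ℕ.⊔ K) ℕ.≤ n → N₁ ℕ.≤ n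
        N₁≤ = λ n ≤n → ℕ.m⊔n≤o⇒m≤o N₁ K (ℕ.m⊔n≤o⇒n≤o N₀ _ ≤n)
    in
    N₀ ℕ.⊔ (N₁ ℕ.⊔ K) , λ m n ≤m ≤n → begin
      ∣ S m ℚ.- S n ∣
        ≤⟨ triangle (S m) (P m) (S n) ⟩
      ∣ S m ℚ.- P m ∣ ℚ.+ ∣ P m ℚ.- S n ∣
        ≤⟨ ℚ.+-monoʳ-≤ ∣ S m ℚ.- P m ∣ (triangle (P m) (P n) (S n)) ⟩
      ∣ S m ℚ.- P m ∣ ℚ.+ (∣ P m ℚ.- P n ∣ ℚ.+ ∣ P n ℚ.- S n ∣)
        ≤⟨ ℚ.+-mono-≤ (near m ≤m) (ℚ.+-mono-≤ (p m n (N₁≤ m ≤m) (N₁≤ n ≤n))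
             (subst (ℚ._≤ δ) (∣p-q∣≡∣q-p∣ (S n) (P n)) (near n ≤n))) ⟩
      δ ℚ.+ (δ ℚ.+ δ)
        ≡⟨ solve 1 (λ d → d :+ (d :+ d) := (con 1ℚ :+ con 1ℚ :+ con 1ℚ) :* d) refl δ ⟩
      (1ℚ ℚ.+ 1ℚ ℚ.+ 1ℚ) ℚ.* δ ∎
    where open ℚ.≤-Reasoning

n*1/n≡1 : ∀ n .{{_ : ℕ.NonZero n}} → fromℕℚ n ℚ.* (ℤ.+ 1 ℚ./ n) ≡ 1ℚ
n*1/n≡1 n = fraction-* 1 n

0<fromℕℚ : ∀ n .{{_ : ℕ.NonZero n}} → 0ℚ ℚ.< fromℕℚ n
0<fromℕℚ n = ℚ.<-≤-trans 0<1 (fromℕℚ-mono {1} {n} (ℕ.>-nonZero⁻¹ n))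

0<1/ : ∀ n .{{_ : ℕ.NonZero n}} → 0ℚ ℚ.< ℤ.+ 1 ℚ./ n
0<1/ n = ℚ.*-cancelˡ-<-nonNeg (fromℕℚ n) {{ℚ.nonNegative (0≤fromℕℚ n)}}
  (subst₂ ℚ._<_ (sym (ℚ.*-zeroʳ (fromℕℚ n))) (sym (n*1/n≡1 n)) 0<1)

1/≤1 : ∀ n .{{_ : ℕ.NonZero n}} → ℤ.+ 1 ℚ./ n ℚ.≤ 1ℚ
1/≤1 n = *-cancel-≤ (0<fromℕℚ n) (subst₂ ℚ._≤_ (sym (n*1/n≡1 n)) (sym (ℚ.*-identityʳ (fromℕℚ n)))
  (fromℕℚ-mono {1} {n} (ℕ.>-nonZero⁻¹ n)))

expTerm : ℕ → ℚ → ℚ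
expTerm k p = p ^ℚ k ℚ.* (ℤ.+ 1 ℚ./ (k ℕ.!)) {{k ℕ.!≢0}}

artanhTerm : ℕ → ℚ → ℚ
artanhTerm k p = p ^ℚ suc (2 ℕ.* k) ℚ.* (ℤ.+ 1 ℚ./ suc (2 ℕ.* k))

expTerm-bound : ∀ a .{{_ : ℕ.NonZero a}} p → ∣ p ∣ ℚ.≤ fromℕℚ a ℚ.* (1ℚ ℚ.- ½) → ∀ k →
                ∣ expTerm k p ∣ ℚ.≤ fromℕℚ (a ℕ.^ a) ℚ.* (1ℚ ℚ.- ½) ^ℚ k
expTerm-bound a p p≤ k = begin
  ∣ p ^ℚ k ℚ.* r ∣              ≡⟨ ℚ.∣p*q∣≡∣p∣*∣q∣ (p ^ℚ k) r ⟩
  ∣ p ^ℚ k ∣ ℚ.* ∣ r ∣          ≡⟨ cong₂ ℚ._*_ (∣p^n∣≡∣p∣^n p k) (ℚ.0≤p⇒∣p∣≡p 0≤r) ⟩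
  ∣ p ∣ ^ℚ k ℚ.* r              ≤⟨ *-mono-≤ʳ 0≤r (^-mono-≤ k (ℚ.0≤∣p∣ p) p≤) ⟩
  (fromℕℚ a ℚ.* h) ^ℚ k ℚ.* r   ≡⟨ cong (ℚ._* r) (^ℚ-distrib-* (fromℕℚ a) h k) ⟩
  fromℕℚ a ^ℚ k ℚ.* h ^ℚ k ℚ.* r
    ≡⟨ solve 3 (λ x y z → x :* y :* z := x :* z :* y) refl (fromℕℚ a ^ℚ k) (h ^ℚ k) r ⟩
  fromℕℚ a ^ℚ k ℚ.* r ℚ.* h ^ℚ k
    ≤⟨ *-mono-≤ʳ (0≤^ k (ℚ.<⇒≤ (ℚ.positive⁻¹ h))) ratio ⟩
  fromℕℚ (a ℕ.^ a) ℚ.* h ^ℚ k ∎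
  where
  open ℚ.≤-Reasoning
  instance _ = k ℕ.!≢0
  h = 1ℚ ℚ.- ½
  r = ℤ.+ 1 ℚ./ (k ℕ.!)
  0≤r = ℚ.<⇒≤ (0<1/ (k ℕ.!))
  ratio : fromℕℚ a ^ℚ k ℚ.* r ℚ.≤ fromℕℚ (a ℕ.^ a)
  ratio = begin
    fromℕℚ a ^ℚ k ℚ.* r                           ≡⟨ cong (ℚ._* r) (fromℕℚ-^ a k) ⟨
    fromℕℚ (a ℕ.^ k) ℚ.* r                        ≤⟨ *-mono-≤ʳ 0≤r (fromℕℚ-mono (a^k≤a^a*k! a k)) ⟩
    fromℕℚ (a ℕ.^ a ℕ.* k ℕ.!) ℚ.* r              ≡⟨ cong (ℚ._* r) (fromℕℚ-* (a ℕ.^ a) (k ℕ.!)) ⟩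
    fromℕℚ (a ℕ.^ a) ℚ.* fromℕℚ (k ℕ.!) ℚ.* r     ≡⟨ ℚ.*-assoc (fromℕℚ (a ℕ.^ a)) _ r ⟩
    fromℕℚ (a ℕ.^ a) ℚ.* (fromℕℚ (k ℕ.!) ℚ.* r)   ≡⟨ cong (fromℕℚ (a ℕ.^ a) ℚ.*_) (n*1/n≡1 (k ℕ.!)) ⟩
    fromℕℚ (a ℕ.^ a) ℚ.* 1ℚ                       ≡⟨ ℚ.*-identityʳ _ ⟩
    fromℕℚ (a ℕ.^ a)                              ∎

abstract
  exp-cauchy : ∀ {f} → IsCauchy f → IsCauchy (λ n → sum< n (λ k → expTerm k (f n)))
  exp-cauchy {f} c =
    let B , 0<B , f≤B = bounded c
        m , 2B≤m = archimedean ((1ℚ ℚ.+ 1ℚ) ℚ.* B)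
        a = suc m
        B≤ : B ℚ.≤ fromℕℚ a ℚ.* (1ℚ ℚ.- ½)
        B≤ = subst (ℚ._≤ fromℕℚ a ℚ.* (1ℚ ℚ.- ½))
               (solve 1 (λ b → (con 1ℚ :+ con 1ℚ) :* b :* con ½ := b) refl B)
               (*-mono-≤ʳ (ℚ.<⇒≤ (ℚ.positive⁻¹ ½)) (ℚ.≤-trans 2B≤m (fromℕℚ-mono (ℕ.n≤1+n m))))
    in series-cauchy (0≤fromℕℚ (a ℕ.^ a)) (ℚ.positive⁻¹ ½) (ℚ.≤ᵇ⇒≤ _)
         (λ k n → expTerm k (f n))
         (λ k → *-cauchy (^-cauchy k c) (const-cauchy _))
         0 (λ n _ k → expTerm-bound a (f n) (ℚ.≤-trans (f≤B n) B≤) k)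

^-antimono-≤ : ∀ {p} → 0ℚ ℚ.≤ p → p ℚ.≤ 1ℚ → ∀ {k j} → k ℕ.≤ j → p ^ℚ j ℚ.≤ p ^ℚ k
^-antimono-≤ {p} 0≤p p≤1 {k} {j} k≤j = subst (λ j → p ^ℚ j ℚ.≤ p ^ℚ k) (ℕ.m∸n+n≡m k≤j) (go (j ℕ.∸ k))
  where
  go : ∀ i → p ^ℚ (i ℕ.+ k) ℚ.≤ p ^ℚ k
  go zero = ℚ.≤-refl
  go (suc i) = ℚ.≤-trans
    (subst (p ^ℚ suc (i ℕ.+ k) ℚ.≤_) (ℚ.*-identityˡ _) (*-mono-≤ʳ (0≤^ (i ℕ.+ k) 0≤p) p≤1))
    (go i)

artanhTerm-bound : ∀ {p q} → ∣ p ∣ ℚ.≤ q → q ℚ.≤ 1ℚ → ∀ k → ∣ artanhTerm k p ∣ ℚ.≤ 1ℚ ℚ.* q ^ℚ k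
artanhTerm-bound {p} {q} p≤q q≤1 k = begin
  ∣ p ^ℚ j ℚ.* r ∣          ≡⟨ ℚ.∣p*q∣≡∣p∣*∣q∣ (p ^ℚ j) r ⟩
  ∣ p ^ℚ j ∣ ℚ.* ∣ r ∣      ≡⟨ cong₂ ℚ._*_ (∣p^n∣≡∣p∣^n p j) (ℚ.0≤p⇒∣p∣≡p 0≤r) ⟩
  ∣ p ∣ ^ℚ j ℚ.* r
    ≤⟨ *-mono-≤ (0≤^ k 0≤q) 0≤r
         (ℚ.≤-trans (^-mono-≤ j (ℚ.0≤∣p∣ p) p≤q) (^-antimono-≤ 0≤q q≤1 k≤j)) (1/≤1 j) ⟩
  q ^ℚ k ℚ.* 1ℚ             ≡⟨ ℚ.*-comm (q ^ℚ k) 1ℚ ⟩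
  1ℚ ℚ.* q ^ℚ k             ∎
  where
  open ℚ.≤-Reasoning
  j = suc (2 ℕ.* k)
  r = ℤ.+ 1 ℚ./ j
  0≤r = ℚ.<⇒≤ (0<1/ j)
  0≤q = ℚ.≤-trans (ℚ.0≤∣p∣ p) p≤q
  k≤j : k ℕ.≤ j
  k≤j = ℕ.m≤n⇒m≤1+n (ℕ.m≤m+n k _)

below-1 : ∀ {p g s} → s ℚ.≤ g → p ℚ.+ g ℚ.≤ 1ℚ → p ℚ.≤ 1ℚ ℚ.- s
below-1 {p} {g} {s} s≤g p+g≤1 = 0≤q-p⇒p≤q (subst (0ℚ ℚ.≤_)
  (solve 2 (λ p s → con 1ℚ :- (p :+ s) := con 1ℚ :- s :- p) refl p s)
  (p≤q⇒0≤q-p (ℚ.≤-trans (ℚ.+-monoʳ-≤ p s≤g) p+g≤1)))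

above--1 : ∀ {p g s} → s ℚ.≤ g → ℚ.- 1ℚ ℚ.+ g ℚ.≤ p → ℚ.- p ℚ.≤ 1ℚ ℚ.- s
above--1 {p} {g} {s} s≤g -1+g≤p = 0≤q-p⇒p≤q (subst (0ℚ ℚ.≤_)
  (solve 2 (λ p s → p :- (:- con 1ℚ :+ s) := con 1ℚ :- s :- :- p) refl p s)
  (p≤q⇒0≤q-p (ℚ.≤-trans (ℚ.+-monoʳ-≤ (ℚ.- 1ℚ) s≤g) -1+g≤p)))

1-s≤1 : ∀ {s} → 0ℚ ℚ.< s → 1ℚ ℚ.- s ℚ.≤ 1ℚ
1-s≤1 {s} 0<s = 0≤q-p⇒p≤q
  (subst (0ℚ ℚ.≤_) (solve 1 (λ s → s := con 1ℚ :- (con 1ℚ :- s)) refl s) (ℚ.<⇒≤ 0<s))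

artanhTerm-cauchy : ∀ {f} k → IsCauchy f → IsCauchy (λ n → artanhTerm k (f n))
artanhTerm-cauchy k c = *-cauchy (^-cauchy (suc (2 ℕ.* k)) c) (const-cauchy (ℤ.+ 1 ℚ./ suc (2 ℕ.* k)))

common-gap : ∀ {a b c} → 0ℚ ℚ.< a → 0ℚ ℚ.< b → 0ℚ ℚ.< c →
             ∃[ s ] (0ℚ ℚ.< s × s ℚ.≤ a × s ℚ.≤ b × s ℚ.≤ c)
common-gap {a} {b} {c} 0<a 0<b 0<c = a ℚ.⊓ (b ℚ.⊓ c) , 0<⊓ 0<a (0<⊓ 0<b 0<c) ,
  ℚ.p⊓q≤p a (b ℚ.⊓ c) ,
  ℚ.≤-trans (ℚ.p⊓q≤q a (b ℚ.⊓ c)) (ℚ.p⊓q≤p b c) ,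
  ℚ.≤-trans (ℚ.p⊓q≤q a (b ℚ.⊓ c)) (ℚ.p⊓q≤q b c)
  where
  0<⊓ : ∀ {p q} → 0ℚ ℚ.< p → 0ℚ ℚ.< q → 0ℚ ℚ.< p ℚ.⊓ q
  0<⊓ {p} {q} 0<p 0<q with ℚ.⊓-sel p q
  ... | inj₁ eq = subst (0ℚ ℚ.<_) (sym eq) 0<p
  ... | inj₂ eq = subst (0ℚ ℚ.<_) (sym eq) 0<q

abstract
  artanh-cauchy : ∀ y → - 1ℝ < y → y < 1ℝ → IsCauchy (λ n → sum< n (λ k → artanhTerm k (approx y n)))
  artanh-cauchy y (mk< g 0<g M p) (mk< h 0<h N q) with common-gap 0<1 0<g 0<h
  ... | s , 0<s , s≤1 , s≤g , s≤h =
    series-cauchy {1ℚ} {s} (ℚ.<⇒≤ 0<1) 0<s s≤1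
      (λ k n → artanhTerm k (approx y n))
      (λ k → artanhTerm-cauchy k (cauchy y))
      (M ℕ.⊔ N)
      (λ n ≤n → artanhTerm-bound {approx y n} {1ℚ ℚ.- s}
        (∣p∣≤ (below-1 s≤h (q n (ℕ.m⊔n≤o⇒n≤o M N ≤n))) (above--1 s≤g (p n (ℕ.m⊔n≤o⇒m≤o M N ≤n))))
        (1-s≤1 {s} 0<s))

exp : ℝ → ℝ
exp x = mkℝ (λ n → sum< n (λ k → expTerm k (approx x n))) (exp-cauchy (cauchy x))

artanh : (y : ℝ) → - 1ℝ < y → y < 1ℝ → ℝ
artanh y -1<y y<1 = mkℝ (λ n → sum< n (λ k → artanhTerm k (approx y n))) (artanh-cauchy y -1<y y<1)

0<x⇒0<x+1 : ∀ x → 0ℝ < x → 0ℝ < x + 1ℝ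
0<x⇒0<x+1 x (mk< g 0<g N p) = mk< g 0<g N λ n N≤n → ℚ.≤-trans (p n N≤n)
  (subst (ℚ._≤ approx x n ℚ.+ 1ℚ) (ℚ.+-identityʳ _) (ℚ.+-monoʳ-≤ (approx x n) (ℚ.<⇒≤ 0<1)))

cayley : (x : ℝ) → 0ℝ < x → ℝ
cayley x 0<x = (x - 1ℝ) / (x + 1ℝ) [ 0<x⇒0<x+1 x 0<x ]

module Cayley (x : ℝ) (0<x : 0ℝ < x) where
  g = gap 0<x
  B = proj₁ (bounded (cauchy x))
  0<B+1 : 0ℚ ℚ.< B ℚ.+ 1ℚ
  0<B+1 = 0<+ (proj₁ (proj₂ (bounded (cauchy x)))) (ℚ.<⇒≤ 0<1)
  r = recip (B ℚ.+ 1ℚ) 0<B+1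
  0<r = 0<recip (B ℚ.+ 1ℚ) 0<B+1
  module _ (n : ℕ) (N≤n : from 0<x ℕ.≤ n) where
    X = approx x n
    i = approx (inverse (x + 1ℝ) (0<x⇒0<x+1 x 0<x)) n
    g≤X : g ℚ.≤ X
    g≤X = subst (ℚ._≤ X) (ℚ.+-identityˡ g) (bound 0<x n N≤n)
    0<X+1 : 0ℚ ℚ.< X ℚ.+ 1ℚ
    0<X+1 = 0<+ (ℚ.<-≤-trans (gap>0 0<x) g≤X) (ℚ.<⇒≤ 0<1)
    Xi : (X ℚ.+ 1ℚ) ℚ.* i ≡ 1ℚ
    Xi = trans (cong (ℚ._* i) (sym (ℚ.p≤q⇒p⊔q≡q (ℚ.≤-trans g≤X
           (subst (ℚ._≤ X ℚ.+ 1ℚ) (ℚ.+-identityʳ X) (ℚ.+-monoʳ-≤ X (ℚ.<⇒≤ 0<1)))))))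
           (recip-inverseʳ (g ℚ.⊔ (X ℚ.+ 1ℚ)) (0<δ⊔ (X ℚ.+ 1ℚ) (gap>0 0<x)))
    r≤i : r ℚ.≤ i
    r≤i = *-cancel-≤ 0<X+1 (begin
      (X ℚ.+ 1ℚ) ℚ.* r
        ≤⟨ *-mono-≤ʳ (ℚ.<⇒≤ 0<r) (ℚ.+-monoˡ-≤ 1ℚ
             (ℚ.≤-trans (p≤∣p∣ X) (proj₂ (proj₂ (bounded (cauchy x))) n))) ⟩
      (B ℚ.+ 1ℚ) ℚ.* r   ≡⟨ recip-inverseʳ (B ℚ.+ 1ℚ) 0<B+1 ⟩
      1ℚ                 ≡⟨ Xi ⟨
      (X ℚ.+ 1ℚ) ℚ.* i   ∎)
      where open ℚ.≤-Reasoning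
    upper : (X ℚ.+ ℚ.- 1ℚ) ℚ.* i ℚ.+ (r ℚ.+ r) ℚ.≤ 1ℚ
    upper = begin
      (X ℚ.+ ℚ.- 1ℚ) ℚ.* i ℚ.+ (r ℚ.+ r)
        ≤⟨ ℚ.+-monoʳ-≤ ((X ℚ.+ ℚ.- 1ℚ) ℚ.* i) (ℚ.+-mono-≤ r≤i r≤i) ⟩
      (X ℚ.+ ℚ.- 1ℚ) ℚ.* i ℚ.+ (i ℚ.+ i)
        ≡⟨ solve 2 (λ x i → (x :+ :- con 1ℚ) :* i :+ (i :+ i) := (x :+ con 1ℚ) :* i) refl X i ⟩
      (X ℚ.+ 1ℚ) ℚ.* i   ≡⟨ Xi ⟩
      1ℚ ∎
      where open ℚ.≤-Reasoning
    lower : ℚ.- 1ℚ ℚ.+ g ℚ.* (r ℚ.+ r) ℚ.≤ (X ℚ.+ ℚ.- 1ℚ) ℚ.* i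
    lower = begin
      ℚ.- 1ℚ ℚ.+ g ℚ.* (r ℚ.+ r)
        ≤⟨ ℚ.+-monoʳ-≤ (ℚ.- 1ℚ) (*-mono-≤ (ℚ.≤-trans (ℚ.<⇒≤ (gap>0 0<x)) g≤X)
             (ℚ.<⇒≤ (0<+ 0<r (ℚ.<⇒≤ 0<r))) g≤X (ℚ.+-mono-≤ r≤i r≤i)) ⟩
      ℚ.- 1ℚ ℚ.+ X ℚ.* (i ℚ.+ i)
        ≡⟨ cong (λ z → ℚ.- z ℚ.+ X ℚ.* (i ℚ.+ i)) Xi ⟨
      ℚ.- ((X ℚ.+ 1ℚ) ℚ.* i) ℚ.+ X ℚ.* (i ℚ.+ i)
        ≡⟨ solve 2 (λ x i → :- ((x :+ con 1ℚ) :* i) :+ x :* (i :+ i) := (x :+ :- con 1ℚ) :* i) refl X i ⟩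
      (X ℚ.+ ℚ.- 1ℚ) ℚ.* i ∎
      where open ℚ.≤-Reasoning

-1<cayley : ∀ x (0<x : 0ℝ < x) → - 1ℝ < cayley x 0<x
-1<cayley x 0<x = mk< (g ℚ.* (r ℚ.+ r)) (0<* (gap>0 0<x) (0<+ 0<r (ℚ.<⇒≤ 0<r))) (from 0<x) lower
  where open Cayley x 0<x

cayley<1 : ∀ x (0<x : 0ℝ < x) → cayley x 0<x < 1ℝ
cayley<1 x 0<x = mk< (r ℚ.+ r) (0<+ 0<r (ℚ.<⇒≤ 0<r)) (from 0<x) upper
  where open Cayley x 0<x

-- log x = 2 artanh ((x - 1) / (x + 1)) for every x > 0; artanh is summed from
-- its power series at a point of (-1, 1).
log : (x : ℝ) → 0ℝ < x → ℝ
log x 0<x = fromℕ 2 * artanh (cayley x 0<x) (-1<cayley x 0<x) (cayley<1 x 0<x)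

infixr 9 _^[_]_

_^[_]_ : (x : ℝ) → 0ℝ < x → ℝ → ℝ
x ^[ 0<x ] s = exp (s * log x 0<x)

0<fromℕ : ∀ n .{{_ : ℕ.NonZero n}} → 0ℝ < fromℕ n
0<fromℕ n = mk< 1ℚ 0<1 0 (λ _ _ → fromℕℚ-mono {1} {n} (ℕ.>-nonZero⁻¹ n))

0<x*y : ∀ x y → 0ℝ < x → 0ℝ < y → 0ℝ < x * y
0<x*y x y (mk< g 0<g M p) (mk< h 0<h N q) = mk< (g ℚ.* h) (0<* 0<g 0<h) (M ℕ.⊔ N) λ n ≤n →
  let g≤ = subst (ℚ._≤ approx x n) (ℚ.+-identityˡ g) (p n (ℕ.m⊔n≤o⇒m≤o M N ≤n))
      h≤ = subst (ℚ._≤ approx y n) (ℚ.+-identityˡ h) (q n (ℕ.m⊔n≤o⇒n≤o M N ≤n))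
  in subst (ℚ._≤ approx x n ℚ.* approx y n) (sym (ℚ.+-identityˡ (g ℚ.* h)))
       (*-mono-≤ (ℚ.≤-trans (ℚ.<⇒≤ 0<g) g≤) (ℚ.<⇒≤ 0<h) g≤ h≤)

0<1ℝ : 0ℝ < 1ℝ
0<1ℝ = 0<fromℕ 1

0<x^n : ∀ x n → (n ≢ 0 → 0ℝ < x) → 0ℝ < x ^ n
0<x^n x zero h = 0<1ℝ
0<x^n x (suc zero) h = 0<x*y x 1ℝ (h λ ()) 0<1ℝ
0<x^n x (suc (suc n)) h = 0<x*y x (x ^ suc n) (h λ ()) (0<x^n x (suc n) (λ _ → h λ ()))

recip-antimono-≤ : ∀ {p q} (0<p : 0ℚ ℚ.< p) (0<q : 0ℚ ℚ.< q) → p ℚ.≤ q → 0ℚ ℚ.+ recip q 0<q ℚ.≤ recip p 0<p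
recip-antimono-≤ {p} {q} 0<p 0<q p≤q = subst (ℚ._≤ recip p 0<p) (sym (ℚ.+-identityˡ (recip q 0<q)))
  (*-cancel-≤ 0<p (ℚ.≤-trans (*-mono-≤ʳ (ℚ.<⇒≤ (0<recip q 0<q)) p≤q)
    (ℚ.≤-reflexive (trans (recip-inverseʳ q 0<q) (sym (recip-inverseʳ p 0<p))))))

⊔≤+ : ∀ {g p B} → 0ℚ ℚ.≤ g → 0ℚ ℚ.≤ B → ∣ p ∣ ℚ.≤ B → g ℚ.⊔ p ℚ.≤ g ℚ.+ B
⊔≤+ {g} {p} {B} 0≤g 0≤B p≤B = ℚ.⊔-lub
  (subst (ℚ._≤ g ℚ.+ B) (ℚ.+-identityʳ g) (ℚ.+-monoʳ-≤ g 0≤B))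
  (ℚ.≤-trans (ℚ.≤-trans (p≤∣p∣ p) p≤B)
    (subst (ℚ._≤ g ℚ.+ B) (ℚ.+-identityˡ B) (ℚ.+-monoˡ-≤ B 0≤g)))

0<inverse : ∀ x (0<x : 0ℝ < x) → 0ℝ < inverse x 0<x
0<inverse x 0<x = mk< (recip (g ℚ.+ B) 0<g+B) (0<recip (g ℚ.+ B) 0<g+B) 0 λ n _ →
  recip-antimono-≤ {g ℚ.⊔ approx x n} {g ℚ.+ B} (0<δ⊔ (approx x n) 0<g) 0<g+B
    (⊔≤+ {g} {approx x n} {B} (ℚ.<⇒≤ 0<g) (ℚ.<⇒≤ 0<B) (proj₂ (proj₂ (bounded (cauchy x))) n))
  where
  g = gap 0<x
  0<g = gap>0 0<x
  B = proj₁ (bounded (cauchy x))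
  0<B = proj₁ (proj₂ (bounded (cauchy x)))
  0<g+B : 0ℚ ℚ.< g ℚ.+ B
  0<g+B = 0<+ 0<g (ℚ.<⇒≤ 0<B)

0<x/y : ∀ x y → 0ℝ < x → (0<y : 0ℝ < y) → 0ℝ < x / y [ 0<y ]
0<x/y x y 0<x 0<y = 0<x*y x (inverse y 0<y) 0<x (0<inverse y 0<y)

first≤sum : ∀ t → (∀ k → 0ℚ ℚ.≤ t k) → ∀ j → t 0 ℚ.≤ sum< (suc j) t
first≤sum t 0≤t zero = ℚ.≤-reflexive {t 0} {0ℚ ℚ.+ t 0} (sym (ℚ.+-identityˡ (t 0)))
first≤sum t 0≤t (suc j) = ℚ.≤-trans (first≤sum t 0≤t j)
  (subst (ℚ._≤ sum< (suc (suc j)) t) (ℚ.+-identityʳ (sum< (suc j) t))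
    (ℚ.+-monoʳ-≤ (sum< (suc j) t) (0≤t (suc j))))

0≤artanhTerm : ∀ {p} → 0ℚ ℚ.≤ p → ∀ k → 0ℚ ℚ.≤ artanhTerm k p
0≤artanhTerm {p} 0≤p k = 0≤* {p ^ℚ suc (2 ℕ.* k)} {ℤ.+ 1 ℚ./ suc (2 ℕ.* k)}
  (0≤^ (suc (2 ℕ.* k)) 0≤p) (ℚ.<⇒≤ (0<1/ (suc (2 ℕ.* k))))

artanhTerm-zero : ∀ p → artanhTerm 0 p ≡ p
artanhTerm-zero p = trans (ℚ.*-identityʳ (p ℚ.* 1ℚ)) (ℚ.*-identityʳ p)

p≤artanhSum : ∀ {p} → 0ℚ ℚ.≤ p → ∀ j → p ℚ.≤ sum< (suc j) (λ k → artanhTerm k p)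
p≤artanhSum {p} 0≤p j = ℚ.≤-trans (ℚ.≤-reflexive (sym (artanhTerm-zero p)))
  (first≤sum (λ k → artanhTerm k p) (0≤artanhTerm 0≤p) j)

0<artanh : ∀ y (-1<y : - 1ℝ < y) (y<1 : y < 1ℝ) → 0ℝ < y → 0ℝ < artanh y -1<y y<1
0<artanh y -1<y y<1 (mk< g 0<g N p) = mk< g 0<g (suc N) λ where
  (suc j) N<n →
    let g≤y = p (suc j) (ℕ.<⇒≤ N<n) in
    ℚ.≤-trans g≤y (p≤artanhSum
      (ℚ.≤-trans (ℚ.<⇒≤ 0<g) (subst (ℚ._≤ approx y (suc j)) (ℚ.+-identityˡ g) g≤y)) j)

1+p≤q⇒p≤q-1 : ∀ {p q} → 1ℚ ℚ.+ p ℚ.≤ q → 0ℚ ℚ.+ p ℚ.≤ q ℚ.- 1ℚ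
1+p≤q⇒p≤q-1 {p} {q} h = 0≤q-p⇒p≤q (subst (0ℚ ℚ.≤_)
  (solve 2 (λ p q → q :- (con 1ℚ :+ p) := q :- con 1ℚ :- (con 0ℚ :+ p)) refl p q) (p≤q⇒0≤q-p h))

1<x⇒0<x-1 : ∀ x → 1ℝ < x → 0ℝ < x - 1ℝ
1<x⇒0<x-1 x (mk< g 0<g N p) = mk< g 0<g N λ n N≤n → 1+p≤q⇒p≤q-1 {g} {approx x n} (p n N≤n)

0<cayley : ∀ x (0<x : 0ℝ < x) → 1ℝ < x → 0ℝ < cayley x 0<x
0<cayley x 0<x 1<x = 0<x/y (x - 1ℝ) (x + 1ℝ) (1<x⇒0<x-1 x 1<x) (0<x⇒0<x+1 x 0<x)

0<log : ∀ x (0<x : 0ℝ < x) → 1ℝ < x → 0ℝ < log x 0<x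
0<log x 0<x 1<x =
  0<x*y (fromℕ 2) (artanh (cayley x 0<x) (-1<cayley x 0<x) (cayley<1 x 0<x)) (0<fromℕ 2)
    (0<artanh (cayley x 0<x) (-1<cayley x 0<x) (cayley<1 x 0<x) (0<cayley x 0<x 1<x))

1<fromℕ : ∀ n → 2 ℕ.≤ n → 1ℝ < fromℕ n
1<fromℕ n 2≤n = mk< 1ℚ 0<1 0 (λ _ _ → fromℕℚ-mono {2} {n} 2≤n)

primeDivisors : ℕ → List ℕ
primeDivisors n = filter (λ p → prime? p ×-dec p ∣? n) (upTo (suc n))

ω : ℕ → ℕ
ω n = length (primeDivisors n)

γ : ℕ → ℕ
γ n = product (primeDivisors n)

2≤prime : ∀ {p} → Prime p → 2 ℕ.≤ p
2≤prime {p} pr = ℕ.nonTrivial⇒n>1 p {{prime⇒nonTrivial pr}}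

primes : ∀ n → All Prime (primeDivisors n)
primes n = All.map proj₁ (all-filter (λ p → prime? p ×-dec p ∣? n) (upTo (suc n)))

1≤product : ∀ {ps} → All Prime ps → 1 ℕ.≤ product ps
1≤product [] = ℕ.≤-refl
1≤product (pr ∷ prs) = ℕ.*-mono-≤ (ℕ.≤-trans (s≤s z≤n) (2≤prime pr)) (1≤product prs)

2≤product : ∀ {ps} → All Prime ps → length ps ≢ 0 → 2 ℕ.≤ product ps
2≤product [] ps≢[] with () ← ps≢[] refl
2≤product (pr ∷ prs) _ = ℕ.*-mono-≤ (2≤prime pr) (1≤product prs)

γ≢0 : ∀ n → ℕ.NonZero (γ n)
γ≢0 n = ℕ.>-nonZero (1≤product (primes n))

0<γ : ∀ n → 0ℝ < fromℕ (γ n)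
0<γ n = 0<fromℕ (γ n) {{γ≢0 n}}

logγ : ℕ → ℝ
logγ n = log (fromℕ (γ n)) (0<γ n)

-- If ω n = 0 then γ n = 1 and log (γ n) is not positive, but x ^ 0 = 1.
0<logγ^ω : ∀ n → 0ℝ < logγ n ^ ω n
0<logγ^ω n = 0<x^n (logγ n) (ω n) λ ω≢0 →
  0<log (fromℕ (γ n)) (0<γ n) (1<fromℕ (γ n) (2≤product (primes n) ω≢0))

H : ℕ → ℝ
H n = fromℕ (γ n) / logγ n ^ ω n [ 0<logγ^ω n ]

0<H : ∀ n → 0ℝ < H n
0<H n = 0<x/y (fromℕ (γ n)) (logγ n ^ ω n) (0<γ n) (0<logγ^ω n)

Conjecture1 : Set
Conjecture1 = ∀ ε → 0ℝ < ε → ∃[ C ]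
  (∀ a b c .{{_ : ℕ.NonZero a}} .{{_ : ℕ.NonZero b}} .{{_ : ℕ.NonZero c}} →
   gcd (gcd a b) c ≡ 1 → a ℕ.+ b ≡ c →
   let n = a ℕ.* b ℕ.* c in fromℕ c < C * H n ^[ 0<H n ] (1ℝ + ε))

ABC-Conjecture : Set
ABC-Conjecture = ∀ ε → 0ℝ < ε → ∃[ C ]
  (∀ a b c .{{_ : ℕ.NonZero a}} .{{_ : ℕ.NonZero b}} .{{_ : ℕ.NonZero c}} →
   gcd (gcd a b) c ≡ 1 → a ℕ.+ b ≡ c →
   let n = a ℕ.* b ℕ.* c in fromℕ c < C * fromℕ (γ n) ^[ 0<γ n ] (1ℝ + ε))

{-# OPTIONS --safe #-}

-- log γ(n) ≥ 1 once γ(n) ≥ 3, and γ(n) ≤ 2 forces ω(n) ≤ 1; in both cases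
-- H(n) ≤ max(γ(n), 3).  Hence H(n)^s is at most γ(n)^s or 3^s, and C(ε) need only
-- be multiplied by a constant depending on s = 1 + ε.
-- All inequalities are shown for the rational approximations of a large index m, up
-- to a factor 2: H(n) may be less than 1, and monotonicity of the truncated exponential
-- series is only clear at non-negative arguments.  At p ≤ 0 the Cauchy product of the
-- m-term partial sums at p and -p is 1 with an error O(2⁻ᵐ), so the sum at p lies in [0, 2].
module Submission where

open import Data.Nat as ℕ using (ℕ; zero; suc; z≤n; s≤s)
import Data.Nat.Properties as ℕ
import Data.Integer as ℤ
open import Data.Rational as ℚ using (ℚ; 0ℚ; 1ℚ; ∣_∣)
import Data.Rational.Properties as ℚ
open import Data.Rational.Solver using (module +-*-Solver)
open import Data.List using (length)
open import Data.Nat.ListAction using (product)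
open import Data.List.Relation.Unary.All using (All; []; _∷_)
open import Data.Nat.Primality using (Prime)
open import Data.Product using (_×_; _,_; proj₁; proj₂; ∃-syntax)
open import Data.Sum using (inj₁; inj₂)
open import Relation.Nullary using (Dec; yes; no; contradiction)
open import Function using (_∘_)
open import Relation.Binary.PropositionalEquality
  using (_≡_; refl; sym; trans; cong; cong₂; subst; subst₂; module ≡-Reasoning)
open import Algebra.Definitions.RawSemiring ℚ.+-*-rawSemiring using () renaming (_^_ to infixr 8 _^ℚ_)
open import Algebra.Bundles using (CommutativeRing)
open import Algebra.Properties.CommutativeSemiring.Exp
  (CommutativeRing.commutativeSemiring ℚ.+-*-commutativeRing)
  using () renaming (^-distrib-* to ^ℚ-distrib-*; ^-homo-* to ^ℚ-homo-*)
open +-*-Solver using (solve; _:=_; _:+_; _:*_; _:-_; :-_; con)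
open import Defs

-- Finite sums of rationals.

sum<-cong : ∀ n {f g} → (∀ k → k ℕ.< n → f k ≡ g k) → sum< n f ≡ sum< n g
sum<-cong zero f≡g = refl
sum<-cong (suc n) f≡g =
  cong₂ ℚ._+_ (sum<-cong n (λ k k<n → f≡g k (ℕ.m<n⇒m<1+n k<n))) (f≡g n ℕ.≤-refl)

sum<-mono : ∀ n {f g} → (∀ k → f k ℚ.≤ g k) → sum< n f ℚ.≤ sum< n g
sum<-mono zero f≤g = ℚ.≤-refl
sum<-mono (suc n) f≤g = ℚ.+-mono-≤ (sum<-mono n f≤g) (f≤g n)

sum<-zero : ∀ n {f} → (∀ k → k ℕ.< n → f k ≡ 0ℚ) → sum< n f ≡ 0ℚ
sum<-zero zero f≡0 = refl
sum<-zero (suc n) f≡0 =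
  cong₂ ℚ._+_ (sum<-zero n (λ k k<n → f≡0 k (ℕ.m<n⇒m<1+n k<n))) (f≡0 n ℕ.≤-refl)

0≤sum< : ∀ n {f} → (∀ k → 0ℚ ℚ.≤ f k) → 0ℚ ℚ.≤ sum< n f
0≤sum< zero 0≤f = ℚ.≤-refl
0≤sum< (suc n) 0≤f = ℚ.+-mono-≤ (0≤sum< n 0≤f) (0≤f n)

sum<-+ : ∀ n f g → sum< n (λ k → f k ℚ.+ g k) ≡ sum< n f ℚ.+ sum< n g
sum<-+ zero f g = refl
sum<-+ (suc n) f g = trans (cong (ℚ._+ (f n ℚ.+ g n)) (sum<-+ n f g))
  (solve 4 (λ a b c d → (a :+ b) :+ (c :+ d) := (a :+ c) :+ (b :+ d)) refl
    (sum< n f) (sum< n g) (f n) (g n))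

sum<-*ˡ : ∀ c n f → sum< n (λ k → c ℚ.* f k) ≡ c ℚ.* sum< n f
sum<-*ˡ c zero f = sym (ℚ.*-zeroʳ c)
sum<-*ˡ c (suc n) f = trans (cong (ℚ._+ c ℚ.* f n) (sum<-*ˡ c n f)) (sym (ℚ.*-distribˡ-+ c (sum< n f) (f n)))

sum<-*ʳ : ∀ c n f → sum< n (λ k → f k ℚ.* c) ≡ sum< n f ℚ.* c
sum<-*ʳ c zero f = sym (ℚ.*-zeroˡ c)
sum<-*ʳ c (suc n) f = trans (cong (ℚ._+ f n ℚ.* c) (sum<-*ʳ c n f)) (sym (ℚ.*-distribʳ-+ c (sum< n f) (f n)))

sum<-suc : ∀ n f → sum< (suc n) f ≡ f 0 ℚ.+ sum< n (f ∘ suc)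
sum<-suc zero f = ℚ.+-comm 0ℚ (f 0)
sum<-suc (suc n) f = trans (cong (ℚ._+ f (suc n)) (sum<-suc n f)) (ℚ.+-assoc (f 0) (sum< n (f ∘ suc)) (f (suc n)))

∣sum<∣≤ : ∀ n f → ∣ sum< n f ∣ ℚ.≤ sum< n (λ k → ∣ f k ∣)
∣sum<∣≤ zero f = ℚ.≤-refl
∣sum<∣≤ (suc n) f = ℚ.≤-trans (ℚ.∣p+q∣≤∣p∣+∣q∣ (sum< n f) (f n)) (ℚ.+-monoˡ-≤ ∣ f n ∣ (∣sum<∣≤ n f))

-- Cauchy products of partial sums, with a weighted error bound.

conv : (ℕ → ℚ) → (ℕ → ℚ) → ℕ → ℚ
conv a b m = sum< (suc m) (λ i → a i ℚ.* b (m ℕ.∸ i))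

-- Both sides add the products over the triangle i + j < n, by diagonals and by rows. Passing from n
-- to n + 1 lengthens each row i ≤ n by the entry with j = n - i, and these entries form the new
-- diagonal.
sum<-conv : ∀ a b n → sum< n (conv a b) ≡ sum< n (λ i → a i ℚ.* sum< (n ℕ.∸ i) b)
sum<-conv a b zero = refl
sum<-conv a b (suc n) = sym (begin
  sum< (suc n) (λ i → a i ℚ.* sum< (suc n ℕ.∸ i) b)
    ≡⟨ sum<-cong (suc n) (λ i i<1+n → trans
         (cong (λ j → a i ℚ.* sum< j b) (ℕ.+-∸-assoc 1 (ℕ.s≤s⁻¹ i<1+n)))
         (ℚ.*-distribˡ-+ (a i) (sum< (n ℕ.∸ i) b) (b (n ℕ.∸ i)))) ⟩
  sum< (suc n) (λ i → a i ℚ.* sum< (n ℕ.∸ i) b ℚ.+ a i ℚ.* b (n ℕ.∸ i))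
    ≡⟨ sum<-+ (suc n) (λ i → a i ℚ.* sum< (n ℕ.∸ i) b) (λ i → a i ℚ.* b (n ℕ.∸ i)) ⟩
  sum< n (λ i → a i ℚ.* sum< (n ℕ.∸ i) b) ℚ.+ a n ℚ.* sum< (n ℕ.∸ n) b ℚ.+ conv a b n
    ≡⟨ cong (ℚ._+ conv a b n) (cong₂ ℚ._+_ (sym (sum<-conv a b n))
         (trans (cong (λ j → a n ℚ.* sum< j b) (ℕ.n∸n≡0 n)) (ℚ.*-zeroʳ (a n)))) ⟩
  sum< n (conv a b) ℚ.+ 0ℚ ℚ.+ conv a b n
    ≡⟨ cong (ℚ._+ conv a b n) (ℚ.+-identityʳ (sum< n (conv a b))) ⟩
  sum< n (conv a b) ℚ.+ conv a b n ∎)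
  where open ≡-Reasoning

1≤^ : ∀ {c} n → 1ℚ ℚ.≤ c → 1ℚ ℚ.≤ c ^ℚ n
1≤^ zero 1≤c = ℚ.≤-refl
1≤^ {c} (suc n) 1≤c = *-mono-≤ {1ℚ} {c} {1ℚ} (ℚ.≤-trans (ℚ.<⇒≤ 0<1) 1≤c) (ℚ.<⇒≤ 0<1) 1≤c (1≤^ n 1≤c)

module _ {c : ℚ} (1≤c : 1ℚ ℚ.≤ c) where
  private
    0≤c : 0ℚ ℚ.≤ c
    0≤c = ℚ.≤-trans (ℚ.<⇒≤ 0<1) 1≤c
    weighted : (ℕ → ℚ) → ℕ → ℚ
    weighted a i = c ^ℚ i ℚ.* ∣ a i ∣
    0≤weighted : ∀ a i → 0ℚ ℚ.≤ weighted a i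
    0≤weighted a i = 0≤* (0≤^ i 0≤c) (ℚ.0≤∣p∣ (a i))

  ^-monoʳ-≤+ : ∀ i k → c ^ℚ k ℚ.≤ c ^ℚ (i ℕ.+ k)
  ^-monoʳ-≤+ zero k = ℚ.≤-refl
  ^-monoʳ-≤+ (suc i) k = ℚ.≤-trans (^-monoʳ-≤+ i k)
    (subst (ℚ._≤ c ℚ.* c ^ℚ (i ℕ.+ k)) (ℚ.*-identityˡ (c ^ℚ (i ℕ.+ k))) (*-mono-≤ʳ (0≤^ (i ℕ.+ k) 0≤c) 1≤c))

  -- Every term beyond index k carries a weight of at least cᵏ. The upper index is written i + k for
  -- induction on i.
  weighted-tail : ∀ b k i → c ^ℚ k ℚ.* ∣ sum< (i ℕ.+ k) b ℚ.- sum< k b ∣ ℚ.≤ sum< (i ℕ.+ k) (weighted b)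
  weighted-tail b k zero = subst (ℚ._≤ sum< k (weighted b))
    (sym (trans (cong (λ z → c ^ℚ k ℚ.* ∣ z ∣) (ℚ.+-inverseʳ (sum< k b))) (ℚ.*-zeroʳ (c ^ℚ k))))
    (0≤sum< k (0≤weighted b))
  weighted-tail b k (suc i) = begin
    c ^ℚ k ℚ.* ∣ S′ ℚ.+ b J ℚ.- S ∣
      ≡⟨ cong (λ z → c ^ℚ k ℚ.* ∣ z ∣) (solve 3 (λ x y z → x :+ y :- z := (x :- z) :+ y) refl S′ (b J) S) ⟩
    c ^ℚ k ℚ.* ∣ (S′ ℚ.- S) ℚ.+ b J ∣
      ≤⟨ *-mono-≤ˡ (0≤^ k 0≤c) (ℚ.∣p+q∣≤∣p∣+∣q∣ (S′ ℚ.- S) (b J)) ⟩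
    c ^ℚ k ℚ.* (∣ S′ ℚ.- S ∣ ℚ.+ ∣ b J ∣)
      ≡⟨ ℚ.*-distribˡ-+ (c ^ℚ k) ∣ S′ ℚ.- S ∣ ∣ b J ∣ ⟩
    c ^ℚ k ℚ.* ∣ S′ ℚ.- S ∣ ℚ.+ c ^ℚ k ℚ.* ∣ b J ∣
      ≤⟨ ℚ.+-mono-≤ (weighted-tail b k i) (*-mono-≤ʳ (ℚ.0≤∣p∣ (b J)) (^-monoʳ-≤+ i k)) ⟩
    sum< J (weighted b) ℚ.+ weighted b J ∎
    where
    open ℚ.≤-Reasoning
    J = i ℕ.+ k
    S = sum< k b
    S′ = sum< J b

  -- The error consists of the products aᵢ bⱼ with i, j < n ≤ i + j, so it gains
  -- a factor cⁿ when aᵢ and bⱼ are weighted by cⁱ and cʲ.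
  cauchy-product : ∀ a b n →
    c ^ℚ n ℚ.* ∣ sum< n a ℚ.* sum< n b ℚ.- sum< n (conv a b) ∣
      ℚ.≤ sum< n (λ i → c ^ℚ i ℚ.* ∣ a i ∣) ℚ.* sum< n (λ i → c ^ℚ i ℚ.* ∣ b i ∣)
  cauchy-product a b n = begin
    c ^ℚ n ℚ.* ∣ A ℚ.* B ℚ.- sum< n (conv a b) ∣
      ≡⟨ cong (λ z → c ^ℚ n ℚ.* ∣ z ∣) split ⟩
    c ^ℚ n ℚ.* ∣ sum< n (λ i → a i ℚ.* (B ℚ.- B∸ i)) ∣
      ≤⟨ *-mono-≤ˡ (0≤^ n 0≤c) (∣sum<∣≤ n (λ i → a i ℚ.* (B ℚ.- B∸ i))) ⟩
    c ^ℚ n ℚ.* sum< n (λ i → ∣ a i ℚ.* (B ℚ.- B∸ i) ∣)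
      ≡⟨ sum<-*ˡ (c ^ℚ n) n (λ i → ∣ a i ℚ.* (B ℚ.- B∸ i) ∣) ⟨
    sum< n (λ i → c ^ℚ n ℚ.* ∣ a i ℚ.* (B ℚ.- B∸ i) ∣)
      ≡⟨ sum<-cong n regroup ⟩
    sum< n (λ i → weighted a i ℚ.* (c ^ℚ (n ℕ.∸ i) ℚ.* ∣ B ℚ.- B∸ i ∣))
      ≤⟨ sum<-mono n (λ i → *-mono-≤ˡ (0≤weighted a i) (tail i)) ⟩
    sum< n (λ i → weighted a i ℚ.* sum< n (weighted b))
      ≡⟨ sum<-*ʳ (sum< n (weighted b)) n (weighted a) ⟩
    sum< n (weighted a) ℚ.* sum< n (weighted b) ∎
    where
    open ℚ.≤-Reasoning
    A = sum< n a
    B = sum< n b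
    B∸ : ℕ → ℚ
    B∸ i = sum< (n ℕ.∸ i) b
    -- Row i of the full square contains all of `B`, row i of the triangle only its first n - i
    -- terms; what remains is a tail of `b`.
    split : A ℚ.* B ℚ.- sum< n (conv a b) ≡ sum< n (λ i → a i ℚ.* (B ℚ.- B∸ i))
    split = begin-equality
      A ℚ.* B ℚ.- sum< n (conv a b)
        ≡⟨ cong (λ z → A ℚ.* B ℚ.- z) (sum<-conv a b n) ⟩
      A ℚ.* B ℚ.- sum< n (λ i → a i ℚ.* B∸ i)
        ≡⟨ cong₂ ℚ._+_ (sym (sum<-*ʳ B n a))
             (trans (solve 1 (λ z → :- z := con (ℚ.- 1ℚ) :* z) refl (sum< n (λ i → a i ℚ.* B∸ i)))
               (sym (sum<-*ˡ (ℚ.- 1ℚ) n (λ i → a i ℚ.* B∸ i)))) ⟩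
      sum< n (λ i → a i ℚ.* B) ℚ.+ sum< n (λ i → ℚ.- 1ℚ ℚ.* (a i ℚ.* B∸ i))
        ≡⟨ sum<-+ n (λ i → a i ℚ.* B) (λ i → ℚ.- 1ℚ ℚ.* (a i ℚ.* B∸ i)) ⟨
      sum< n (λ i → a i ℚ.* B ℚ.+ ℚ.- 1ℚ ℚ.* (a i ℚ.* B∸ i))
        ≡⟨ sum<-cong n (λ i _ → solve 3 (λ x y z → x :* y :+ con (ℚ.- 1ℚ) :* (x :* z) := x :* (y :- z))
             refl (a i) B (B∸ i)) ⟩
      sum< n (λ i → a i ℚ.* (B ℚ.- B∸ i)) ∎
    regroup : ∀ i → i ℕ.< n → c ^ℚ n ℚ.* ∣ a i ℚ.* (B ℚ.- B∸ i) ∣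
                ≡ weighted a i ℚ.* (c ^ℚ (n ℕ.∸ i) ℚ.* ∣ B ℚ.- B∸ i ∣)
    regroup i i<n = begin-equality
      c ^ℚ n ℚ.* ∣ a i ℚ.* (B ℚ.- B∸ i) ∣
        ≡⟨ cong₂ ℚ._*_ (trans (cong (c ^ℚ_) (sym (ℕ.m+[n∸m]≡n (ℕ.<⇒≤ i<n)))) (^ℚ-homo-* c i (n ℕ.∸ i)))
             (ℚ.∣p*q∣≡∣p∣*∣q∣ (a i) (B ℚ.- B∸ i)) ⟩
      (c ^ℚ i ℚ.* c ^ℚ (n ℕ.∸ i)) ℚ.* (∣ a i ∣ ℚ.* ∣ B ℚ.- B∸ i ∣)
        ≡⟨ solve 4 (λ x y z w → (x :* y) :* (z :* w) := (x :* z) :* (y :* w)) refl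
             (c ^ℚ i) (c ^ℚ (n ℕ.∸ i)) ∣ a i ∣ ∣ B ℚ.- B∸ i ∣ ⟩
      weighted a i ℚ.* (c ^ℚ (n ℕ.∸ i) ℚ.* ∣ B ℚ.- B∸ i ∣) ∎
    -- `sum<-mono` asks for every i, so the upper index n is reached as (n ∸ i) + (n ∸ (n ∸ i)),
    -- which is correct for i > n as well.
    tail : ∀ i → c ^ℚ (n ℕ.∸ i) ℚ.* ∣ B ℚ.- B∸ i ∣ ℚ.≤ sum< n (weighted b)
    tail i = subst (λ j → c ^ℚ (n ℕ.∸ i) ℚ.* ∣ sum< j b ℚ.- B∸ i ∣ ℚ.≤ sum< j (weighted b))
      (ℕ.m+[n∸m]≡n (ℕ.m∸n≤m n i))
      (subst (λ j → c ^ℚ (n ℕ.∸ i) ℚ.* ∣ sum< j b ℚ.- B∸ i ∣ ℚ.≤ sum< j (weighted b))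
        (ℕ.+-comm (n ℕ.∸ (n ℕ.∸ i)) (n ℕ.∸ i)) (weighted-tail b (n ℕ.∸ i) (n ℕ.∸ (n ℕ.∸ i))))

-- Binomial recursion for the terms of the exponential series.

fromℕℚ-+ : ∀ m n → fromℕℚ (m ℕ.+ n) ≡ fromℕℚ m ℚ.+ fromℕℚ n
fromℕℚ-+ zero n = sym (ℚ.+-identityˡ (fromℕℚ n))
fromℕℚ-+ (suc m) n = begin
  fromℕℚ (suc (m ℕ.+ n))               ≡⟨ fromℕℚ-suc (m ℕ.+ n) ⟩
  1ℚ ℚ.+ fromℕℚ (m ℕ.+ n)              ≡⟨ cong (1ℚ ℚ.+_) (fromℕℚ-+ m n) ⟩
  1ℚ ℚ.+ (fromℕℚ m ℚ.+ fromℕℚ n)       ≡⟨ ℚ.+-assoc 1ℚ (fromℕℚ m) (fromℕℚ n) ⟨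
  1ℚ ℚ.+ fromℕℚ m ℚ.+ fromℕℚ n         ≡⟨ cong (ℚ._+ fromℕℚ n) (fromℕℚ-suc m) ⟨
  fromℕℚ (suc m) ℚ.+ fromℕℚ n          ∎
  where open ≡-Reasoning

-- The only fact about factorials that the binomial recursion uses; clearing the denominator avoids
-- division there.
expTerm-suc : ∀ k p → fromℕℚ (suc k) ℚ.* expTerm (suc k) p ≡ p ℚ.* expTerm k p
expTerm-suc k p = begin
  s ℚ.* (p ℚ.* p ^ℚ k ℚ.* r′)
    ≡⟨ solve 4 (λ s p x r → s :* (p :* x :* r) := p :* (x :* (s :* r))) refl s p (p ^ℚ k) r′ ⟩
  p ℚ.* (p ^ℚ k ℚ.* (s ℚ.* r′))
    ≡⟨ cong (λ z → p ℚ.* (p ^ℚ k ℚ.* z)) (sym r≡sr′) ⟩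
  p ℚ.* (p ^ℚ k ℚ.* r) ∎
  where
  open ≡-Reasoning
  s = fromℕℚ (suc k)
  r = (ℤ.+ 1 ℚ./ (k ℕ.!)) {{k ℕ.!≢0}}
  r′ = (ℤ.+ 1 ℚ./ (suc k ℕ.!)) {{suc k ℕ.!≢0}}
  r≡sr′ : r ≡ s ℚ.* r′
  r≡sr′ = begin
    r                                  ≡⟨ ℚ.*-identityʳ r ⟨
    r ℚ.* 1ℚ                           ≡⟨ cong (r ℚ.*_) (n*1/n≡1 (suc k ℕ.!) {{suc k ℕ.!≢0}}) ⟨
    r ℚ.* (fromℕℚ (suc k ℕ.!) ℚ.* r′)  ≡⟨ cong (λ z → r ℚ.* (z ℚ.* r′)) (fromℕℚ-* (suc k) (k ℕ.!)) ⟩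
    r ℚ.* (s ℚ.* fromℕℚ (k ℕ.!) ℚ.* r′)
      ≡⟨ solve 4 (λ r s f t → r :* (s :* f :* t) := f :* r :* (s :* t)) refl r s (fromℕℚ (k ℕ.!)) r′ ⟩
    fromℕℚ (k ℕ.!) ℚ.* r ℚ.* (s ℚ.* r′) ≡⟨ cong (ℚ._* (s ℚ.* r′)) (n*1/n≡1 (k ℕ.!) {{k ℕ.!≢0}}) ⟩
    1ℚ ℚ.* (s ℚ.* r′)                  ≡⟨ ℚ.*-identityˡ (s ℚ.* r′) ⟩
    s ℚ.* r′                           ∎

-- The binomial theorem, as the recursion satisfied by (p + q)ᵐ / m!.
expTerm-conv-suc : ∀ p q m → let c = conv (λ i → expTerm i p) (λ j → expTerm j q) in
  fromℕℚ (suc m) ℚ.* c (suc m) ≡ (p ℚ.+ q) ℚ.* c m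
expTerm-conv-suc p q m = begin
  fromℕℚ (suc m) ℚ.* conv a b (suc m)
    ≡⟨ sum<-*ˡ (fromℕℚ (suc m)) (suc (suc m)) (λ i → a i ℚ.* b (suc m ℕ.∸ i)) ⟨
  sum< (suc (suc m)) (λ i → fromℕℚ (suc m) ℚ.* (a i ℚ.* b (suc m ℕ.∸ i)))
    ≡⟨ sum<-cong (suc (suc m)) leibniz ⟩
  sum< (suc (suc m)) (λ i → X i ℚ.+ Y i)
    ≡⟨ sum<-+ (suc (suc m)) X Y ⟩
  sum< (suc (suc m)) X ℚ.+ sum< (suc (suc m)) Y
    ≡⟨ cong₂ ℚ._+_ sumX sumY ⟩
  p ℚ.* conv a b m ℚ.+ q ℚ.* conv a b m
    ≡⟨ ℚ.*-distribʳ-+ (conv a b m) p q ⟨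
  (p ℚ.+ q) ℚ.* conv a b m ∎
  where
  open ≡-Reasoning
  a b X Y : ℕ → ℚ
  a i = expTerm i p
  b j = expTerm j q
  X i = fromℕℚ i ℚ.* a i ℚ.* b (suc m ℕ.∸ i)
  Y i = a i ℚ.* (fromℕℚ (suc m ℕ.∸ i) ℚ.* b (suc m ℕ.∸ i))
  -- As in the product rule, m + 1 = i + (m + 1 - i): `X` lowers the degree of the first factor and
  -- `Y` that of the second. `X` vanishes at i = 0 and `Y` at i = m + 1, which leaves m + 1 terms in
  -- each sum.
  leibniz : ∀ i → i ℕ.< suc (suc m) → fromℕℚ (suc m) ℚ.* (a i ℚ.* b (suc m ℕ.∸ i)) ≡ X i ℚ.+ Y i
  leibniz i i≤ = trans
    (cong (ℚ._* (a i ℚ.* b (suc m ℕ.∸ i)))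
      (trans (cong fromℕℚ (sym (ℕ.m+[n∸m]≡n (ℕ.s≤s⁻¹ i≤)))) (fromℕℚ-+ i (suc m ℕ.∸ i))))
    (solve 4 (λ u v x y → (u :+ v) :* (x :* y) := u :* x :* y :+ x :* (v :* y)) refl
      (fromℕℚ i) (fromℕℚ (suc m ℕ.∸ i)) (a i) (b (suc m ℕ.∸ i)))
  sumX : sum< (suc (suc m)) X ≡ p ℚ.* conv a b m
  sumX = begin
    sum< (suc (suc m)) X
      ≡⟨ sum<-suc (suc m) X ⟩
    X 0 ℚ.+ sum< (suc m) (X ∘ suc)
      ≡⟨ cong₂ ℚ._+_ (trans (cong (ℚ._* b (suc m)) (ℚ.*-zeroˡ (a 0))) (ℚ.*-zeroˡ (b (suc m))))
           (sum<-cong (suc m) (λ i _ → trans (cong (ℚ._* b (m ℕ.∸ i)) (expTerm-suc i p))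
             (ℚ.*-assoc p (a i) (b (m ℕ.∸ i))))) ⟩
    0ℚ ℚ.+ sum< (suc m) (λ i → p ℚ.* (a i ℚ.* b (m ℕ.∸ i)))
      ≡⟨ ℚ.+-identityˡ _ ⟩
    sum< (suc m) (λ i → p ℚ.* (a i ℚ.* b (m ℕ.∸ i)))
      ≡⟨ sum<-*ˡ p (suc m) (λ i → a i ℚ.* b (m ℕ.∸ i)) ⟩
    p ℚ.* conv a b m ∎
  sumY : sum< (suc (suc m)) Y ≡ q ℚ.* conv a b m
  sumY = begin
    sum< (suc m) Y ℚ.+ Y (suc m)
      ≡⟨ cong₂ ℚ._+_ (sum<-cong (suc m) step)
           (trans (cong (λ j → a (suc m) ℚ.* (fromℕℚ j ℚ.* b j)) (ℕ.n∸n≡0 (suc m)))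
             (trans (cong (a (suc m) ℚ.*_) (ℚ.*-zeroˡ (b 0))) (ℚ.*-zeroʳ (a (suc m))))) ⟩
    sum< (suc m) (λ i → q ℚ.* (a i ℚ.* b (m ℕ.∸ i))) ℚ.+ 0ℚ
      ≡⟨ ℚ.+-identityʳ _ ⟩
    sum< (suc m) (λ i → q ℚ.* (a i ℚ.* b (m ℕ.∸ i)))
      ≡⟨ sum<-*ˡ q (suc m) (λ i → a i ℚ.* b (m ℕ.∸ i)) ⟩
    q ℚ.* conv a b m ∎
    where
    step : ∀ i → i ℕ.< suc m → Y i ≡ q ℚ.* (a i ℚ.* b (m ℕ.∸ i))
    step i i<1+m = begin
      Y i
        ≡⟨ cong (λ j → a i ℚ.* (fromℕℚ j ℚ.* b j)) (ℕ.+-∸-assoc 1 (ℕ.s≤s⁻¹ i<1+m)) ⟩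
      a i ℚ.* (fromℕℚ (suc (m ℕ.∸ i)) ℚ.* b (suc (m ℕ.∸ i)))
        ≡⟨ cong (a i ℚ.*_) (expTerm-suc (m ℕ.∸ i) q) ⟩
      a i ℚ.* (q ℚ.* b (m ℕ.∸ i))
        ≡⟨ solve 3 (λ x q y → x :* (q :* y) := q :* (x :* y)) refl (a i) q (b (m ℕ.∸ i)) ⟩
      q ℚ.* (a i ℚ.* b (m ℕ.∸ i)) ∎

-- Partial sums of the exponential series at arguments of either sign.

expSum : ℕ → ℚ → ℚ
expSum n p = sum< n (λ k → expTerm k p)

-- For q = - p the binomial recursion has the factor p + q = 0, so only coefficient 0 survives;
-- `suc n` guarantees that it is in the sum.
sum<-expTerm-conv-neg : ∀ p n → sum< (suc n) (conv (λ i → expTerm i p) (λ j → expTerm j (ℚ.- p))) ≡ 1ℚ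
sum<-expTerm-conv-neg p n = trans (sum<-suc n c) (cong (c 0 ℚ.+_) (sum<-zero n (λ k _ → c-suc≡0 k)))
  where
  c : ℕ → ℚ
  c = conv (λ i → expTerm i p) (λ j → expTerm j (ℚ.- p))
  c-suc≡0 : ∀ k → c (suc k) ≡ 0ℚ
  c-suc≡0 k = begin
    c (suc k)                                  ≡⟨ ℚ.*-identityˡ (c (suc k)) ⟨
    1ℚ ℚ.* c (suc k)                           ≡⟨ cong (ℚ._* c (suc k)) (n*1/n≡1 (suc k)) ⟨
    fromℕℚ (suc k) ℚ.* r ℚ.* c (suc k)
      ≡⟨ solve 3 (λ x y z → x :* y :* z := y :* (x :* z)) refl (fromℕℚ (suc k)) r (c (suc k)) ⟩
    r ℚ.* (fromℕℚ (suc k) ℚ.* c (suc k))       ≡⟨ cong (r ℚ.*_) (expTerm-conv-suc p (ℚ.- p) k) ⟩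
    r ℚ.* ((p ℚ.- p) ℚ.* c k)
      ≡⟨ solve 3 (λ r p x → r :* ((p :- p) :* x) := con 0ℚ) refl r p (c k) ⟩
    0ℚ ∎
    where
    open ≡-Reasoning
    r = ℤ.+ 1 ℚ./ suc k

-- The weight is absorbed into the argument, so the weighted sums that bound the Cauchy product
-- error are again exponential sums.
weighted-expTerm : ∀ c p k → c ^ℚ k ℚ.* ∣ expTerm k p ∣ ≡ expTerm k (c ℚ.* ∣ p ∣)
weighted-expTerm c p k = begin
  c ^ℚ k ℚ.* ∣ p ^ℚ k ℚ.* r ∣
    ≡⟨ cong (c ^ℚ k ℚ.*_) (trans (ℚ.∣p*q∣≡∣p∣*∣q∣ (p ^ℚ k) r)
         (cong₂ ℚ._*_ (∣p^n∣≡∣p∣^n p k) (ℚ.0≤p⇒∣p∣≡p (ℚ.<⇒≤ (0<1/ (k ℕ.!) {{k ℕ.!≢0}}))))) ⟩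
  c ^ℚ k ℚ.* (∣ p ∣ ^ℚ k ℚ.* r)    ≡⟨ ℚ.*-assoc (c ^ℚ k) (∣ p ∣ ^ℚ k) r ⟨
  c ^ℚ k ℚ.* ∣ p ∣ ^ℚ k ℚ.* r      ≡⟨ cong (ℚ._* r) (^ℚ-distrib-* c ∣ p ∣ k) ⟨
  (c ℚ.* ∣ p ∣) ^ℚ k ℚ.* r         ∎
  where
  open ≡-Reasoning
  r = (ℤ.+ 1 ℚ./ (k ℕ.!)) {{k ℕ.!≢0}}

expTerm-mono : ∀ k {p q} → 0ℚ ℚ.≤ p → p ℚ.≤ q → expTerm k p ℚ.≤ expTerm k q
expTerm-mono k 0≤p p≤q = *-mono-≤ʳ (ℚ.<⇒≤ (0<1/ (k ℕ.!) {{k ℕ.!≢0}})) (^-mono-≤ k 0≤p p≤q)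

expSum-mono : ∀ n {p q} → 0ℚ ℚ.≤ p → p ℚ.≤ q → expSum n p ℚ.≤ expSum n q
expSum-mono n 0≤p p≤q = sum<-mono n (λ k → expTerm-mono k 0≤p p≤q)

1≤expSum : ∀ n {p} → 0ℚ ℚ.≤ p → 1ℚ ℚ.≤ expSum (suc n) p
1≤expSum n {p} 0≤p = first≤sum (λ k → expTerm k p)
  (λ k → 0≤* (0≤^ k 0≤p) (ℚ.<⇒≤ (0<1/ (k ℕ.!) {{k ℕ.!≢0}}))) n

2ℚ : ℚ
2ℚ = fromℕℚ 2

-- The weighted error bound at c = 2: the convolution sums to exactly 1, and both weighted sums are
-- exponential sums at 2|p|.
expSum-inverse : ∀ n p → 2ℚ ^ℚ suc n ℚ.* ∣ expSum (suc n) p ℚ.* expSum (suc n) (ℚ.- p) ℚ.- 1ℚ ∣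
  ℚ.≤ expSum (suc n) (2ℚ ℚ.* ∣ p ∣) ℚ.* expSum (suc n) (2ℚ ℚ.* ∣ p ∣)
expSum-inverse n p = subst₂ ℚ._≤_
  (cong (λ z → 2ℚ ^ℚ suc n ℚ.* ∣ expSum (suc n) p ℚ.* expSum (suc n) (ℚ.- p) ℚ.- z ∣) (sum<-expTerm-conv-neg p n))
  (cong₂ ℚ._*_ (sum<-cong (suc n) (λ k _ → weighted-expTerm 2ℚ p k))
    (sum<-cong (suc n) (λ k _ → trans (weighted-expTerm 2ℚ (ℚ.- p) k)
      (cong (λ z → expTerm k (2ℚ ℚ.* z)) (ℚ.∣-p∣≡∣p∣ p)))))
  (cauchy-product (fromℕℚ-mono {1} {2} (s≤s z≤n)) (λ i → expTerm i p) (λ j → expTerm j (ℚ.- p)) (suc n))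

n≤2^n : ∀ n → n ℕ.≤ 2 ℕ.^ n
n≤2^n zero = z≤n
n≤2^n (suc n) = subst (suc n ℕ.≤_) (cong (2 ℕ.^ n ℕ.+_) (sym (ℕ.+-identityʳ (2 ℕ.^ n))))
  (ℕ.+-mono-≤ (ℕ.m^n>0 2 n) (n≤2^n n))

∣p-1∣≤1⇒0≤p : ∀ {p} → ∣ p ℚ.- 1ℚ ∣ ℚ.≤ 1ℚ → 0ℚ ℚ.≤ p
∣p-1∣≤1⇒0≤p {p} h = subst (0ℚ ℚ.≤_) (solve 1 (λ p → con 1ℚ :- :- (p :- con 1ℚ) := p) refl p)
  (p≤q⇒0≤q-p (ℚ.≤-trans (p≤∣p∣ (ℚ.- (p ℚ.- 1ℚ))) (ℚ.≤-trans (ℚ.≤-reflexive (ℚ.∣-p∣≡∣p∣ (p ℚ.- 1ℚ))) h)))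

∣p-1∣≤1⇒p≤2 : ∀ {p} → ∣ p ℚ.- 1ℚ ∣ ℚ.≤ 1ℚ → p ℚ.≤ 2ℚ
∣p-1∣≤1⇒p≤2 {p} h = subst (ℚ._≤ 2ℚ) (solve 1 (λ p → p :- con 1ℚ :+ con 1ℚ := p) refl p)
  (ℚ.+-monoˡ-≤ 1ℚ (ℚ.≤-trans (p≤∣p∣ (p ℚ.- 1ℚ)) h))

1≤q∧0≤p*q⇒0≤p : ∀ {p q} → 1ℚ ℚ.≤ q → 0ℚ ℚ.≤ p ℚ.* q → 0ℚ ℚ.≤ p
1≤q∧0≤p*q⇒0≤p {p} {q} 1≤q 0≤pq = *-cancel-≤ {q} (ℚ.<-≤-trans 0<1 1≤q)
  (subst₂ ℚ._≤_ (sym (ℚ.*-zeroʳ q)) (ℚ.*-comm p q) 0≤pq)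

p≤p*q : ∀ {p q} → 1ℚ ℚ.≤ q → 0ℚ ℚ.≤ p → p ℚ.≤ p ℚ.* q
p≤p*q {p} {q} 1≤q 0≤p = subst (ℚ._≤ p ℚ.* q) (ℚ.*-identityʳ p) (*-mono-≤ˡ 0≤p 1≤q)

-- Partial sums of the exponential series can be negative at a negative argument,
-- hence the bound only holds eventually.
expSum-nonpos : ∀ y → ∃[ N ] (∀ m → N ℕ.≤ m → approx y m ℚ.≤ 0ℚ →
  0ℚ ℚ.≤ expSum m (approx y m) × expSum m (approx y m) ℚ.≤ 2ℚ)
expSum-nonpos y = suc (proj₁ arch) , bounds
  where
  -- `M` bounds all partial sums for exp(-2y), whose argument at an index where p ≤ 0 is 2 * (- p) =
  -- 2|p|.
  bdd = bounded (exp-cauchy (cauchy (fromℕ 2 * - y)))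
  M = proj₁ bdd
  -- For n beyond this integer, 2 ^ n ≥ n ≥ M * M, so dividing by 2 ^ n brings the error below 1.
  arch = archimedean (M ℚ.* M)
  bounds : ∀ m → suc (proj₁ arch) ℕ.≤ m → approx y m ℚ.≤ 0ℚ →
    0ℚ ℚ.≤ expSum m (approx y m) × expSum m (approx y m) ℚ.≤ 2ℚ
  -- The product of the sums at p and - p lies in [0, 2], and the second factor is at least 1; so
  -- the first inherits both bounds.
  bounds (suc m) N<m p≤0 = 0≤E , ℚ.≤-trans (p≤p*q 1≤E⁻ 0≤E) (∣p-1∣≤1⇒p≤2 error≤1)
    where
    p = approx y (suc m)
    n = suc m
    0≤-p : 0ℚ ℚ.≤ ℚ.- p
    0≤-p = ℚ.neg-antimono-≤ p≤0
    ∣p∣≡-p : ∣ p ∣ ≡ ℚ.- p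
    ∣p∣≡-p = trans (sym (ℚ.∣-p∣≡∣p∣ p)) (ℚ.0≤p⇒∣p∣≡p 0≤-p)
    1≤E⁻ : 1ℚ ℚ.≤ expSum n (ℚ.- p)
    1≤E⁻ = 1≤expSum m 0≤-p
    0≤2∣p∣ : 0ℚ ℚ.≤ 2ℚ ℚ.* ∣ p ∣
    0≤2∣p∣ = 0≤* (0≤fromℕℚ 2) (ℚ.0≤∣p∣ p)
    0≤E₂ : 0ℚ ℚ.≤ expSum n (2ℚ ℚ.* ∣ p ∣)
    0≤E₂ = ℚ.≤-trans (ℚ.<⇒≤ 0<1) (1≤expSum m 0≤2∣p∣)
    E₂≤M : expSum n (2ℚ ℚ.* ∣ p ∣) ℚ.≤ M
    E₂≤M = ℚ.≤-trans (p≤∣p∣ (expSum n (2ℚ ℚ.* ∣ p ∣)))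
      (subst (λ z → ∣ expSum n (2ℚ ℚ.* z) ∣ ℚ.≤ M) (sym ∣p∣≡-p) (proj₂ (proj₂ bdd) n))
    M²≤2^n : M ℚ.* M ℚ.≤ 2ℚ ^ℚ n
    M²≤2^n = ℚ.≤-trans (proj₂ arch) (ℚ.≤-trans
      (fromℕℚ-mono (ℕ.≤-trans (ℕ.<⇒≤ N<m) (n≤2^n n))) (ℚ.≤-reflexive (fromℕℚ-^ 2 n)))
    error≤1 : ∣ expSum n p ℚ.* expSum n (ℚ.- p) ℚ.- 1ℚ ∣ ℚ.≤ 1ℚ
    error≤1 = *-cancel-≤ {2ℚ ^ℚ n}
      (ℚ.<-≤-trans 0<1 (1≤^ n (fromℕℚ-mono {1} {2} (s≤s z≤n))))
      (ℚ.≤-trans (expSum-inverse m p) (ℚ.≤-trans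
        (*-mono-≤ (ℚ.≤-trans 0≤E₂ E₂≤M) 0≤E₂ E₂≤M E₂≤M)
        (ℚ.≤-trans M²≤2^n (ℚ.≤-reflexive (sym (ℚ.*-identityʳ (2ℚ ^ℚ n)))))))
    0≤E : 0ℚ ℚ.≤ expSum n p
    0≤E = 1≤q∧0≤p*q⇒0≤p 1≤E⁻ (∣p-1∣≤1⇒0≤p error≤1)

-- Monotonicity up to a factor 2, for p of unknown sign. If p ≤ 0, the assumed bound 2 suffices
-- because the sum at q ≥ 0 is at least 1.
expSum-dominated : ∀ n {p q} → 0ℚ ℚ.≤ q → p ℚ.≤ q →
  (p ℚ.≤ 0ℚ → 0ℚ ℚ.≤ expSum (suc n) p × expSum (suc n) p ℚ.≤ 2ℚ) →
  0ℚ ℚ.≤ expSum (suc n) p × expSum (suc n) p ℚ.≤ 2ℚ ℚ.* expSum (suc n) q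
expSum-dominated n {p} {q} 0≤q p≤q h with ℚ.≤-total 0ℚ p
... | inj₁ 0≤p = ℚ.≤-trans (ℚ.<⇒≤ 0<1) (1≤expSum n 0≤p) , ℚ.≤-trans (expSum-mono (suc n) 0≤p p≤q)
  (subst (ℚ._≤ 2ℚ ℚ.* expSum (suc n) q) (ℚ.*-identityˡ (expSum (suc n) q))
    (*-mono-≤ʳ (ℚ.≤-trans (ℚ.<⇒≤ 0<1) (1≤expSum n 0≤q)) (fromℕℚ-mono {1} {2} (s≤s z≤n))))
... | inj₂ p≤0 = proj₁ (h p≤0) , ℚ.≤-trans (proj₂ (h p≤0)) (p≤p*q (1≤expSum n 0≤q) (0≤fromℕℚ 2))

-- Monotonicity and lower bounds for artanh and the logarithm.

artanhSum : ℕ → ℚ → ℚ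
artanhSum n p = sum< n (λ k → artanhTerm k p)

0≤p*p : ∀ p → 0ℚ ℚ.≤ p ℚ.* p
0≤p*p p with ℚ.≤-total 0ℚ p
... | inj₁ 0≤p = 0≤* 0≤p 0≤p
... | inj₂ p≤0 = subst (0ℚ ℚ.≤_) (solve 1 (λ p → :- p :* :- p := p :* p) refl p)
  (0≤* (ℚ.neg-antimono-≤ p≤0) (ℚ.neg-antimono-≤ p≤0))

-- The exponents are odd: for p ≤ 0 the even power is a square, so the term at p is at most 0 and
-- the term at q at least 0.
artanhTerm-mono : ∀ k {p q} → 0ℚ ℚ.≤ q → p ℚ.≤ q → artanhTerm k p ℚ.≤ artanhTerm k q
artanhTerm-mono k {p} {q} 0≤q p≤q = *-mono-≤ʳ (ℚ.<⇒≤ (0<1/ (suc (2 ℕ.* k)))) odd-mono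
  where
  0≤p^2k : 0ℚ ℚ.≤ p ^ℚ (2 ℕ.* k)
  0≤p^2k = subst (0ℚ ℚ.≤_)
    (trans (sym (^ℚ-homo-* p k k)) (cong (λ j → p ^ℚ (k ℕ.+ j)) (sym (ℕ.+-identityʳ k)))) (0≤p*p (p ^ℚ k))
  odd-mono : p ^ℚ suc (2 ℕ.* k) ℚ.≤ q ^ℚ suc (2 ℕ.* k)
  odd-mono with ℚ.≤-total 0ℚ p
  ... | inj₁ 0≤p = ^-mono-≤ (suc (2 ℕ.* k)) 0≤p p≤q
  ... | inj₂ p≤0 = ℚ.≤-trans
    (subst (p ^ℚ suc (2 ℕ.* k) ℚ.≤_) (ℚ.*-zeroˡ (p ^ℚ (2 ℕ.* k))) (*-mono-≤ʳ 0≤p^2k p≤0))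
    (0≤^ (suc (2 ℕ.* k)) 0≤q)

artanhSum-mono : ∀ n {p q} → 0ℚ ℚ.≤ q → p ℚ.≤ q → artanhSum n p ℚ.≤ artanhSum n q
artanhSum-mono n 0≤q p≤q = sum<-mono n (λ k → artanhTerm-mono k 0≤q p≤q)

module _ (x : ℝ) (0<x : 0ℝ < x) (m : ℕ) (N≤m : from 0<x ℕ.≤ m) where
  open Cayley x 0<x using (i; X; Xi; r≤i; 0<r; 0<X+1)

  0≤cayley-inverse : 0ℚ ℚ.≤ i m N≤m
  0≤cayley-inverse = ℚ.≤-trans (ℚ.<⇒≤ 0<r) (r≤i m N≤m)

  0≤cayley : 1ℚ ℚ.≤ approx x m → 0ℚ ℚ.≤ approx (cayley x 0<x) m
  0≤cayley 1≤X = 0≤* (p≤q⇒0≤q-p 1≤X) 0≤cayley-inverse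

  -- The first term of the series of 2 artanh gives 2 (x - 1) / (x + 1) ≤ log x.
  log-lower : ∀ c → 1ℚ ℚ.≤ approx x m → c ℚ.* (approx x m ℚ.+ 1ℚ) ℚ.≤ 2ℚ ℚ.* (approx x m ℚ.- 1ℚ) →
    0 ℕ.< m → c ℚ.≤ approx (log x 0<x) m
  log-lower c 1≤X h 0<m = begin
    c                                          ≡⟨ ℚ.*-identityʳ c ⟨
    c ℚ.* 1ℚ                                   ≡⟨ cong (c ℚ.*_) (Xi m N≤m) ⟨
    c ℚ.* ((X m N≤m ℚ.+ 1ℚ) ℚ.* i m N≤m)       ≡⟨ ℚ.*-assoc c (X m N≤m ℚ.+ 1ℚ) (i m N≤m) ⟨
    c ℚ.* (X m N≤m ℚ.+ 1ℚ) ℚ.* i m N≤m         ≤⟨ *-mono-≤ʳ 0≤cayley-inverse h ⟩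
    2ℚ ℚ.* (X m N≤m ℚ.- 1ℚ) ℚ.* i m N≤m        ≡⟨ ℚ.*-assoc 2ℚ (X m N≤m ℚ.- 1ℚ) (i m N≤m) ⟩
    2ℚ ℚ.* approx (cayley x 0<x) m
      ≤⟨ *-mono-≤ˡ (0≤fromℕℚ 2) (artanh-lower m 0<m (0≤cayley 1≤X)) ⟩
    approx (log x 0<x) m                       ∎
    where
    open ℚ.≤-Reasoning
    artanh-lower : ∀ n → 0 ℕ.< n → ∀ {p} → 0ℚ ℚ.≤ p → p ℚ.≤ artanhSum n p
    artanh-lower (suc n) _ 0≤p = p≤artanhSum 0≤p n

  -- (z - 1) / (z + 1) = 1 - 2 / (z + 1) increases with z. Past both `from` indices the clamped
  -- reciprocals are exact inverses.
  cayley-mono : ∀ y (0<y : 0ℝ < y) → from 0<y ℕ.≤ m → approx x m ℚ.≤ approx y m →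
    approx (cayley x 0<x) m ℚ.≤ approx (cayley y 0<y) m
  cayley-mono y 0<y M≤m X≤Y = subst₂ ℚ._≤_ (sym (value X₀ i₀ (Xi m N≤m))) (sym (value Y₀ j₀ Yj))
    (ℚ.+-monoʳ-≤ 1ℚ (ℚ.neg-antimono-≤ (*-mono-≤ˡ {2ℚ} (0≤fromℕℚ 2) j≤i)))
    where
    X₀ = approx x m
    Y₀ = approx y m
    i₀ = i m N≤m
    j₀ = Cayley.i y 0<y m M≤m
    Yj = Cayley.Xi y 0<y m M≤m
    0≤j : 0ℚ ℚ.≤ j₀
    0≤j = ℚ.≤-trans (ℚ.<⇒≤ (Cayley.0<r y 0<y)) (Cayley.r≤i y 0<y m M≤m)
    j≤i : j₀ ℚ.≤ i₀
    j≤i = *-cancel-≤ (0<X+1 m N≤m) (ℚ.≤-trans (*-mono-≤ʳ 0≤j (ℚ.+-monoˡ-≤ 1ℚ X≤Y))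
      (ℚ.≤-reflexive (trans Yj (sym (Xi m N≤m)))))
    value : ∀ z k → (z ℚ.+ 1ℚ) ℚ.* k ≡ 1ℚ → (z ℚ.+ ℚ.- 1ℚ) ℚ.* k ≡ 1ℚ ℚ.- 2ℚ ℚ.* k
    value z k eq = trans
      (solve 2 (λ z k → (z :+ :- con 1ℚ) :* k := (z :+ con 1ℚ) :* k :- con 2ℚ :* k) refl z k)
      (cong (ℚ._- 2ℚ ℚ.* k) eq)

  log-mono : ∀ y (0<y : 0ℝ < y) → from 0<y ℕ.≤ m → approx x m ℚ.≤ approx y m →
    0ℚ ℚ.≤ approx (cayley y 0<y) m → approx (log x 0<x) m ℚ.≤ approx (log y 0<y) m
  log-mono y 0<y M≤m X≤Y 0≤cy = *-mono-≤ˡ {2ℚ} (0≤fromℕℚ 2) (artanhSum-mono m 0≤cy (cayley-mono y 0<y M≤m X≤Y))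

  0≤log : 1ℚ ℚ.≤ approx x m → 0ℚ ℚ.≤ approx (log x 0<x) m
  0≤log 1≤X = 0≤* {2ℚ} (0≤fromℕℚ 2) (0≤sum< m (0≤artanhTerm (0≤cayley 1≤X)))

-- The bound H(n) ≤ max(γ(n), 3).

approx-^ : ∀ x n m → approx (x ^ n) m ≡ approx x m ^ℚ n
approx-^ x zero m = refl
approx-^ x (suc n) m = cong (approx x m ℚ.*_) (approx-^ x n m)

-- Clamping the denominator p from below by g only enlarges it, so a quotient bound obtained from v
-- ≤ p holds at every index.
*-recip-⊔-≤ : ∀ {g p v a b} (0<g : 0ℚ ℚ.< g) → 0ℚ ℚ.≤ b → v ℚ.≤ p → a ℚ.≤ v ℚ.* b →
  a ℚ.* recip (g ℚ.⊔ p) (0<δ⊔ p 0<g) ℚ.≤ b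
*-recip-⊔-≤ {g} {p} {v} {a} {b} 0<g 0≤b v≤p a≤vb = begin
  a ℚ.* r            ≤⟨ *-mono-≤ʳ (ℚ.<⇒≤ (0<recip (g ℚ.⊔ p) (0<δ⊔ p 0<g)))
                          (ℚ.≤-trans a≤vb (*-mono-≤ʳ 0≤b (ℚ.≤-trans v≤p (ℚ.p≤q⊔p g p)))) ⟩
  (g ℚ.⊔ p) ℚ.* b ℚ.* r   ≡⟨ solve 3 (λ d b r → d :* b :* r := b :* (d :* r)) refl (g ℚ.⊔ p) b r ⟩
  b ℚ.* ((g ℚ.⊔ p) ℚ.* r) ≡⟨ cong (b ℚ.*_) (recip-inverseʳ (g ℚ.⊔ p) (0<δ⊔ p 0<g)) ⟩
  b ℚ.* 1ℚ           ≡⟨ ℚ.*-identityʳ b ⟩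
  b                  ∎
  where
  open ℚ.≤-Reasoning
  r = recip (g ℚ.⊔ p) (0<δ⊔ p 0<g)

-- Serves to limit γ(n) < 3 to at most one prime divisor.
2^length≤product : ∀ {ps} → All Prime ps → 2 ℕ.^ length ps ℕ.≤ product ps
2^length≤product [] = ℕ.≤-refl
2^length≤product (pr ∷ prs) = ℕ.*-mono-≤ (2≤prime pr) (2^length≤product prs)

1≤γ : ∀ n → 1 ℕ.≤ γ n
1≤γ n = 1≤product (primes n)

-- The value of 2 (x - 1) / (x + 1) at x = 2, a lower bound for log 2.
⅔ : ℚ
⅔ = ℤ.+ 2 ℚ./ 3

logγ-lower : ∀ n m → 0 ℕ.< m → ∀ c → c ℚ.* (fromℕℚ (γ n) ℚ.+ 1ℚ) ℚ.≤ 2ℚ ℚ.* (fromℕℚ (γ n) ℚ.- 1ℚ) →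
  c ℚ.≤ approx (logγ n) m
logγ-lower n m 0<m c h = log-lower (fromℕ (γ n)) (0<γ n) m z≤n c (fromℕℚ-mono (1≤γ n)) h 0<m

-- 2 (x - 1) / (x + 1) reaches 1 at x = 3, whence the case distinction at 3.
3≤x⇒1+x≤2[x-1] : ∀ {x} → fromℕℚ 3 ℚ.≤ x → 1ℚ ℚ.* (x ℚ.+ 1ℚ) ℚ.≤ 2ℚ ℚ.* (x ℚ.- 1ℚ)
3≤x⇒1+x≤2[x-1] {x} 3≤x = 0≤q-p⇒p≤q (subst (0ℚ ℚ.≤_)
  (solve 1 (λ x → x :- con (fromℕℚ 3) := con 2ℚ :* (x :- con 1ℚ) :- con 1ℚ :* (x :+ con 1ℚ)) refl x)
  (p≤q⇒0≤q-p 3≤x))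

2≤x⇒⅔[1+x]≤2[x-1] : ∀ {x} → 2ℚ ℚ.≤ x → ⅔ ℚ.* (x ℚ.+ 1ℚ) ℚ.≤ 2ℚ ℚ.* (x ℚ.- 1ℚ)
2≤x⇒⅔[1+x]≤2[x-1] {x} 2≤x = 0≤q-p⇒p≤q (subst (0ℚ ℚ.≤_)
  (solve 1 (λ x → con (⅔ ℚ.+ ⅔) :* (x :- con 2ℚ) := con 2ℚ :* (x :- con 1ℚ) :- con ⅔ :* (x :+ con 1ℚ)) refl x)
  (0≤* (ℚ.nonNegative⁻¹ (⅔ ℚ.+ ⅔)) (p≤q⇒0≤q-p 2≤x)))

1≤logγ : ∀ n m → 0 ℕ.< m → 3 ℕ.≤ γ n → 1ℚ ℚ.≤ approx (logγ n) m
1≤logγ n m 0<m 3≤γ = logγ-lower n m 0<m 1ℚ (3≤x⇒1+x≤2[x-1] (fromℕℚ-mono 3≤γ))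

⅔≤logγ : ∀ n m → 0 ℕ.< m → 2 ℕ.≤ γ n → ⅔ ℚ.≤ approx (logγ n) m
⅔≤logγ n m 0<m 2≤γ = logγ-lower n m 0<m ⅔ (2≤x⇒⅔[1+x]≤2[x-1] (fromℕℚ-mono 2≤γ))

p≤q⇒p≤1*q : ∀ {p q} → p ℚ.≤ q → p ℚ.≤ 1ℚ ℚ.* q
p≤q⇒p≤1*q {p} {q} = subst (p ℚ.≤_) (sym (ℚ.*-identityˡ q))

-- The exponent k stands for `ω n`, freed from it so that it can be matched on. Powers of a
-- logarithm ≥ 1 stay ≥ 1; below 3, k = 0 gives 1, k = 1 gives `⅔`, and k ≥ 2 would force γ(n) ≥ 4.
logγ^k-lower : ∀ n m → 0 ℕ.< m → ∀ k → 2 ℕ.^ k ℕ.≤ γ n → Dec (3 ℕ.≤ γ n) →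
  ∃[ v ] (v ℚ.≤ approx (logγ n ^ k) m × fromℕℚ (γ n) ℚ.≤ v ℚ.* fromℕℚ (γ n ℕ.⊔ 3))
logγ^k-lower n m 0<m k 2^k≤γ (yes 3≤γ) = 1ℚ ,
  ℚ.≤-trans (1≤^ k (1≤logγ n m 0<m 3≤γ)) (ℚ.≤-reflexive (sym (approx-^ (logγ n) k m))) ,
  p≤q⇒p≤1*q (fromℕℚ-mono (ℕ.m≤m⊔n (γ n) 3))
logγ^k-lower n m 0<m zero 2^k≤γ (no γ<3) = 1ℚ , ℚ.≤-refl , p≤q⇒p≤1*q (fromℕℚ-mono (ℕ.m≤m⊔n (γ n) 3))
logγ^k-lower n m 0<m (suc zero) 2^k≤γ (no γ<3) = ⅔ ,
  subst (⅔ ℚ.≤_) (sym (ℚ.*-identityʳ (approx (logγ n) m))) (⅔≤logγ n m 0<m 2^k≤γ) ,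
  -- Here γ(n) ≤ 2 = `⅔` * 3, so the loss from dividing by `⅔` is covered by 3.
  ℚ.≤-trans (fromℕℚ-mono {γ n} {2} (ℕ.s≤s⁻¹ (ℕ.≰⇒> γ<3)))
    (*-mono-≤ˡ {⅔} {fromℕℚ 3} {fromℕℚ (γ n ℕ.⊔ 3)} (ℚ.nonNegative⁻¹ ⅔) (fromℕℚ-mono (ℕ.m≤n⊔m (γ n) 3)))
logγ^k-lower n m 0<m (suc (suc k)) 2^k≤γ (no γ<3) = contradiction
  (ℕ.≤-trans (ℕ.≤-trans (ℕ.n≤1+n 3) (ℕ.^-monoʳ-≤ 2 {2} {suc (suc k)} (s≤s (s≤s z≤n)))) 2^k≤γ) γ<3

H≤γ⊔3 : ∀ n m → 0 ℕ.< m → approx (H n) m ℚ.≤ fromℕℚ (γ n ℕ.⊔ 3)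
H≤γ⊔3 n m 0<m =
  let v , v≤ , γ≤ = logγ^k-lower n m 0<m (ω n) (2^length≤product (primes n)) (3 ℕ.≤? γ n)
  in *-recip-⊔-≤ {gap (0<logγ^ω n)} {approx (logγ n ^ ω n) m} {v} {fromℕℚ (γ n)}
       (gap>0 (0<logγ^ω n)) (0≤fromℕℚ (γ n ℕ.⊔ 3)) v≤ γ≤

-- Comparison of log H(n) with log γ(n) or log 3.

log3 : ℝ
log3 = log (fromℕ 3) (0<fromℕ 3)

logH≤logγ : ∀ n m → 0 ℕ.< m → from (0<H n) ℕ.≤ m → 3 ℕ.≤ γ n →
  approx (log (H n) (0<H n)) m ℚ.≤ approx (logγ n) m
logH≤logγ n m 0<m N≤m 3≤γ = log-mono (H n) (0<H n) m N≤m (fromℕ (γ n)) (0<γ n) z≤n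
  (ℚ.≤-trans (H≤γ⊔3 n m 0<m) (fromℕℚ-mono {γ n ℕ.⊔ 3} {γ n} (ℕ.⊔-lub ℕ.≤-refl 3≤γ)))
  (0≤cayley (fromℕ (γ n)) (0<γ n) m z≤n (fromℕℚ-mono (1≤γ n)))

logH≤log3 : ∀ n m → 0 ℕ.< m → from (0<H n) ℕ.≤ m → γ n ℕ.≤ 3 →
  approx (log (H n) (0<H n)) m ℚ.≤ approx log3 m
logH≤log3 n m 0<m N≤m γ≤3 = log-mono (H n) (0<H n) m N≤m (fromℕ 3) (0<fromℕ 3) z≤n
  (ℚ.≤-trans (H≤γ⊔3 n m 0<m) (fromℕℚ-mono {γ n ℕ.⊔ 3} {3} (ℕ.⊔-lub γ≤3 ℕ.≤-refl)))
  (0≤cayley (fromℕ 3) (0<fromℕ 3) m z≤n (fromℕℚ-mono {1} {3} (s≤s z≤n)))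

-- Comparison of H(n)^s with γ(n)^s for fixed s > 0.

module _ (s : ℝ) (0<s : 0ℝ < s) where
  private
    0≤s : ∀ m → from 0<s ℕ.≤ m → 0ℚ ℚ.≤ approx s m
    0≤s m N≤m = ℚ.≤-trans (ℚ.<⇒≤ (gap>0 0<s)) (subst (ℚ._≤ approx s m) (ℚ.+-identityˡ (gap 0<s)) (bound 0<s m N≤m))

    bdd = bounded (cauchy (exp (s * log3)))

  3^s-bound : ℚ
  3^s-bound = proj₁ bdd

  0<3^s-bound : 0ℚ ℚ.< 3^s-bound
  0<3^s-bound = proj₁ (proj₂ bdd)

  -- Independent of n. The 2 is the loss in `expSum-dominated`; the sum 1 + `3^s-bound` replaces a
  -- maximum over the two cases.
  factor : ℚ
  factor = 2ℚ ℚ.* (1ℚ ℚ.+ 3^s-bound)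

  2≤factor : 2ℚ ℚ.≤ factor
  2≤factor = *-mono-≤ˡ {2ℚ} {1ℚ} (0≤fromℕℚ 2)
    (subst (ℚ._≤ 1ℚ ℚ.+ 3^s-bound) (ℚ.+-identityʳ 1ℚ) (ℚ.+-monoʳ-≤ 1ℚ (ℚ.<⇒≤ 0<3^s-bound)))

  2*3^s-bound≤factor : 2ℚ ℚ.* 3^s-bound ℚ.≤ factor
  2*3^s-bound≤factor = *-mono-≤ˡ {2ℚ} {3^s-bound} (0≤fromℕℚ 2)
    (subst (ℚ._≤ 1ℚ ℚ.+ 3^s-bound) (ℚ.+-identityˡ 3^s-bound) (ℚ.+-monoˡ-≤ 3^s-bound (ℚ.<⇒≤ 0<1)))

  module _ (n : ℕ) where
    private
      y x : ℝ
      y = s * log (H n) (0<H n)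
      x = s * logγ n
      eventually = expSum-nonpos y

    -- A sum in place of a maximum; `suc` excludes empty partial sums. It may depend on n, since
    -- `_<_` constrains only late approximations.
    threshold : ℕ
    threshold = suc (from 0<s ℕ.+ (from (0<H n) ℕ.+ proj₁ eventually))

    -- For γ(n) ≥ 3 the exponents compare directly. Otherwise H(n)^s is compared with 3^s, which is
    -- absorbed into `factor` because γ(n)^s ≥ 1.
    H^s≤γ^s : ∀ m → threshold ℕ.≤ m → 0ℚ ℚ.≤ approx (H n ^[ 0<H n ] s) m ×
      approx (H n ^[ 0<H n ] s) m ℚ.≤ factor ℚ.* approx (fromℕ (γ n) ^[ 0<γ n ] s) m
    H^s≤γ^s (suc k) N<m = by-size (3 ℕ.≤? γ n)
      where
      m = suc k
      N≤m = ℕ.<⇒≤ N<m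
      s-ok : from 0<s ℕ.≤ m
      s-ok = ℕ.m+n≤o⇒m≤o (from 0<s) N≤m
      H-ok : from (0<H n) ℕ.≤ m
      H-ok = ℕ.m+n≤o⇒m≤o (from (0<H n)) (ℕ.m+n≤o⇒n≤o (from 0<s) N≤m)
      y-ok : proj₁ eventually ℕ.≤ m
      y-ok = ℕ.m+n≤o⇒n≤o (from (0<H n)) (ℕ.m+n≤o⇒n≤o (from 0<s) N≤m)
      0≤x : 0ℚ ℚ.≤ approx x m
      0≤x = 0≤* (0≤s m s-ok) (0≤log (fromℕ (γ n)) (0<γ n) m z≤n (fromℕℚ-mono (1≤γ n)))
      1≤eˣ : 1ℚ ℚ.≤ expSum m (approx x m)
      1≤eˣ = 1≤expSum k 0≤x
      0≤eˣ = ℚ.≤-trans (ℚ.<⇒≤ 0<1) 1≤eˣ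
      by-size : Dec (3 ℕ.≤ γ n) → 0ℚ ℚ.≤ expSum m (approx y m) ×
        expSum m (approx y m) ℚ.≤ factor ℚ.* expSum m (approx x m)
      by-size (yes 3≤γ) =
        let 0≤eʸ , eʸ≤ = expSum-dominated k 0≤x (*-mono-≤ˡ (0≤s m s-ok) (logH≤logγ n m (s≤s z≤n) H-ok 3≤γ))
                           (proj₂ eventually m y-ok)
        in 0≤eʸ , ℚ.≤-trans eʸ≤ (*-mono-≤ʳ 0≤eˣ 2≤factor)
      by-size (no γ<3) =
        let 0≤eʸ , eʸ≤ = expSum-dominated k
              (0≤* (0≤s m s-ok) (0≤log (fromℕ 3) (0<fromℕ 3) m z≤n (fromℕℚ-mono {1} {3} (s≤s z≤n))))
              (*-mono-≤ˡ (0≤s m s-ok) (logH≤log3 n m (s≤s z≤n) H-ok (ℕ.<⇒≤ (ℕ.≰⇒> γ<3))))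
              (proj₂ eventually m y-ok)
        in 0≤eʸ , ℚ.≤-trans eʸ≤ (ℚ.≤-trans
             (*-mono-≤ˡ {2ℚ} (0≤fromℕℚ 2)
               (ℚ.≤-trans (p≤∣p∣ (expSum m (approx (s * log3) m))) (proj₂ (proj₂ bdd) m)))
             (ℚ.≤-trans 2*3^s-bound≤factor (p≤p*q 1≤eˣ (ℚ.≤-trans (0≤fromℕℚ 2) 2≤factor))))

  -- `C` may have either sign, so it is replaced by a bound on its absolute value; this uses that
  -- the approximations of H(n)^s are eventually nonnegative. The gap is kept unchanged.
  H^s-bound⇒γ^s-bound : ∀ C → ∃[ C′ ] (∀ n x →
    x < C * H n ^[ 0<H n ] s → x < C′ * fromℕ (γ n) ^[ 0<γ n ] s)
  H^s-bound⇒γ^s-bound C = fromℚ (B ℚ.* factor) , λ n x x< →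
    mk< (gap x<) (gap>0 x<) (from x< ℕ.+ threshold n) λ m N≤m →
      let 0≤h , h≤ = H^s≤γ^s n m (ℕ.m+n≤o⇒n≤o (from x<) N≤m)
          h = approx (H n ^[ 0<H n ] s) m
          g = approx (fromℕ (γ n) ^[ 0<γ n ] s) m
      in begin
        approx x m ℚ.+ gap x<     ≤⟨ bound x< m (ℕ.m+n≤o⇒m≤o (from x<) N≤m) ⟩
        approx C m ℚ.* h          ≤⟨ *-mono-≤ʳ 0≤h (ℚ.≤-trans (p≤∣p∣ (approx C m)) (C≤B m)) ⟩
        B ℚ.* h                   ≤⟨ *-mono-≤ˡ (ℚ.<⇒≤ 0<B) h≤ ⟩
        B ℚ.* (factor ℚ.* g)      ≡⟨ ℚ.*-assoc B factor g ⟨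
        B ℚ.* factor ℚ.* g        ∎
    where
    open ℚ.≤-Reasoning
    B = proj₁ (bounded (cauchy C))
    0<B = proj₁ (proj₂ (bounded (cauchy C)))
    C≤B = proj₂ (proj₂ (bounded (cauchy C)))

0<1+ : ∀ ε → 0ℝ < ε → 0ℝ < 1ℝ + ε
0<1+ ε (mk< g 0<g N p) = mk< g 0<g N λ n N≤n → ℚ.+-mono-≤ {0ℚ} {1ℚ} {g} {approx ε n} (ℚ.<⇒≤ 0<1)
  (subst (ℚ._≤ approx ε n) (ℚ.+-identityˡ g) (p n N≤n))

proposition1 : Conjecture1 → ABC-Conjecture
proposition1 conjecture ε 0<ε =
  let C , c<CH = conjecture ε 0<ε
      C′ , improve = H^s-bound⇒γ^s-bound (1ℝ + ε) (0<1+ ε 0<ε) C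
  in C′ , λ a b c gcd≡1 a+b≡c → improve (a ℕ.* b ℕ.* c) (fromℕ c) (c<CH a b c gcd≡1 a+b≡c)
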